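{- For every $n\ge1$, the number of periodic patterns of length $n$ of the tent map $\Lambda=\Sigma_{+- }$, counted up to cyclic rotation, is $$p_n(\Lambda)=\frac{1}{2n}\sum_{\substack{d\mid n\\ d\text{ odd}}}\mu(d)\,2^{n/d},$$ where $\mu$ is the Möbius function.
   Context: For $\sigma\in\{+,-\}^k$ ($k\ge2$), let $\mathcal W_k$ be the set of infinite words over $\{0,\dots,k-1\}$ with the linear order $\prec_\sigma$: for $s\neq t$, with $j$ the first index where $s_j\neq t_j$ and $c=|\{i<j:\sigma_{s_i}=-\}|$, $s\prec_\sigma t$ iff ($c$ even and $s_j<t_j$) or ($c$ odd and $s_j>t_j$). The signed shift $\Sigma_\sigma$ deletes the first letter of a word. Let $\mathcal W_{k,n}$ be the set of words $(s_1\dots s_n)^\infty$ (infinite repetition) with $s_1\dots s_n$ primitive (not a power of a shorter word). For $s\in\mathcal W_{k,n}$ let $\Pi_\sigma(s)\in\mathcal S_n$ be the permutation with $\Pi_\sigma(s)_i<\Pi_\sigma(s)_j$ iff $s_is_{i+1}\dots\prec_\sigma s_js_{j+1}\dots$. Let $\mathcal P_n(\Sigma_\sigma)=\{\Pi_\sigma(s):s\in\mathcal W_{k,n}\}$; this set is closed under cyclic rotation of one-line notation, and $p_n(\Sigma_\sigma)=|\mathcal P_n(\Sigma_\sigma)|/n$ is the number of its classes under cyclic rotation. The tent map is $\Lambda=\Sigma_{+- }$ ($k=2$, $\sigma=+-$). -}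

module Defs where

open import Data.Nat using (ℕ; zero; suc; _+_; _*_; _^_; NonZero)
open import Data.Nat.DivMod using (_%_; _/_; _mod_)
open import Data.Nat.Divisibility using (_∣_; _∣?_)
open import Data.Nat.Primality using (prime?)
import Data.Nat.Properties as ℕP
open import Data.Integer as ℤ using (ℤ; +_; -[1+_])
open import Data.Fin as Fin using (Fin; toℕ)
open import Data.Vec using (Vec; lookup; _∷_; [])
open import Data.List using (List; length; filter; upTo; map; foldr)
import Data.List.Relation.Unary.Unique.Propositional as UniqueP
open import Data.List.Membership.Propositional using (_∈_)
open import Data.Product using (Σ; ∃-syntax; _×_; _,_)
open import Data.Sum using (_⊎_)
open import Data.Bool using (Bool; true; false; not; _∧_; if_then_else_)
open import Relation.Binary.PropositionalEquality using (_≡_; _≢_)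
open import Relation.Nullary using (¬_; ⌊_⌋)
open import Relation.Nullary.Decidable using (_×-dec_)
open import Function.Bundles using (_⇔_)
open import Function.Definitions using (Injective)

data Sign : Set where
  plus minus : Sign

Signs : ℕ → Set
Signs k = Vec Sign k

Word : ℕ → Set
Word k = ℕ → Fin k

isMinus : Sign → ℕ
isMinus plus  = 0
isMinus minus = 1

minusCount : ∀ {k} → Signs k → Word k → ℕ → ℕ
minusCount σ s zero    = 0
minusCount σ s (suc j) = minusCount σ s j + isMinus (lookup σ (s j))

_≺[_]_ : ∀ {k} → Word k → Signs k → Word k → Set
s ≺[ σ ] t = ∃[ j ] ((∀ i → i Data.Nat.< j → s i ≡ t i) ×
   ((minusCount σ s j % 2 ≡ 0 × s j Fin.< t j) ⊎
    (minusCount σ s j % 2 ≡ 1 × t j Fin.< s j)))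

shiftⁿ : ∀ {k} → ℕ → Word k → Word k
shiftⁿ m s i = s (m + i)

periodic : ∀ {k n} .{{_ : NonZero n}} → Vec (Fin k) n → Word k
periodic {n = n} b i = lookup b (i mod n)

-- b₁…bₙ is primitive: it is not a power (u)^{n/d} of a shorter word u of
-- length d ∣ n, d < n; equivalently (b)^∞ has no period d with d ∣ n, d < n.
Primitive : ∀ {k n} .{{_ : NonZero n}} → Vec (Fin k) n → Set
Primitive {n = n} b =
  ¬ (∃[ d ] (d Data.Nat.< n × d ∣ n × (∀ i → periodic b (d + i) ≡ periodic b i)))

IsPatternOf : ∀ {k n} .{{_ : NonZero n}} → Signs k → Vec (Fin k) n → Vec (Fin n) n → Set
IsPatternOf σ b π =
  Injective _≡_ _≡_ (lookup π) ×
  (∀ i j → (lookup π i Fin.< lookup π j) ⇔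
           (shiftⁿ (toℕ i) (periodic b) ≺[ σ ] shiftⁿ (toℕ j) (periodic b)))

IsPattern : ∀ {k} → Signs k → (n : ℕ) → .{{_ : NonZero n}} → Vec (Fin n) n → Set
IsPattern {k} σ n π = ∃[ b ] (Primitive {k} {n} b × IsPatternOf σ b π)

HasCard : ∀ {A : Set} → (A → Set) → ℕ → Set
HasCard {A} P N = Σ (List A) λ xs →
  UniqueP.Unique xs × (∀ x → (x ∈ xs) ⇔ P x) × length xs ≡ N

tent : Signs 2
tent = plus ∷ minus ∷ []

primeDivisors : ℕ → List ℕ
primeDivisors d = filter (λ p → prime? p ×-dec p ∣? d) (upTo (suc d))

-- d squarefree: no m ≥ 2 with m² ∣ d (for d ≥ 1 such m satisfies m ≤ d)
squareFree : ℕ → Bool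
squareFree d = foldr _∧_ true (map (λ m → not ⌊ (2 + m) * (2 + m) ∣? d ⌋) (upTo d))

μ : ℕ → ℤ
μ d = if squareFree d then (-[1+ 0 ]) ℤ.^ length (primeDivisors d) else + 0

tentSum : ℕ → ℤ
tentSum n = foldr ℤ._+_ (+ 0) (map (λ i → μ (suc i) ℤ.* (+ (2 ^ (n / suc i))))
                     (filter (λ i → (suc i ∣? n) ×-dec (suc i % 2 ℕP.≟ 1)) (upTo n)))

{-# OPTIONS --safe #-}
module Submission where

-- Sending b to its pattern is a bijection from the primitive words with an odd number of 1s onto
-- the patterns.  Along a pattern π the point π_i is moved to π_{i+1} by a unimodal map, increasing
-- on the letter 0 and decreasing on the letter 1, so π determines b except for the letter of the
-- point mapped to the maximum, which can be flipped freely; the flip changes the parity of the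
-- number of 1s.  Conversely an odd word whose letters fit π is automatically primitive with
-- pattern π: two points with equal itineraries would exchange their order after one period.
--
-- Half of all words are odd, and for an odd word of length n with least period p the numbers d
-- such that d ∣ n and n/d is a period are the divisors of n/p, all of them odd.  Hence
-- Σ_{d ∣ n, d odd} μ(d) 2^{n/d} is twice the sum over the odd words of Σ_{d ∣ n/p} μ(d) = [p = n].

open import Defs
open import Algebra.Properties.CommutativeSemigroup using (interchange; x∙yz≈y∙xz)
open import Data.Bool using (Bool; true; false; not; if_then_else_)
open import Data.Bool.Properties using (T-≡; ⇔→≡)
open import Data.Fin as Fin using (Fin; toℕ; fromℕ<; opposite; punchOut)
open import Data.Fin.Patterns using (0F; 1F)
import Data.Fin.Properties as Fin
open import Data.Integer using (ℤ; +_; -[1+_]; -_) renaming (_+_ to _⊕_; _*_ to _⊗_)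
import Data.Integer.Properties as ℤ
open import Data.List using (List; []; _∷_; _++_; length; filter; map; foldr; upTo; allFin; cartesianProductWith)
import Data.List.Properties as List
open import Data.List.Membership.Propositional using (_∈_; lose)
open import Data.List.Membership.Propositional.Properties using (∈-filter⁺; ∈-filter⁻; ∈-upTo⁺; ∈-map⁺; ∈-map⁻; ∈-allFin; ∈-cartesianProductWith⁺)
open import Data.List.Membership.Propositional.Properties.WithK using (unique∧set⇒bag)
open import Data.List.Relation.Binary.BagAndSetEquality using (∼bag⇒↭)
open import Data.List.Relation.Binary.Permutation.Propositional as ↭ using (_↭_)
open import Data.List.Relation.Binary.Permutation.Propositional.Properties using (↭-length)
open import Data.List.Relation.Unary.All as All using ([]; _∷_)
import Data.List.Relation.Unary.All.Properties as All
open import Data.List.Relation.Unary.AllPairs using ([]; _∷_)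
open import Data.List.Relation.Unary.Any using (here; there)
open import Data.List.Relation.Unary.Unique.Propositional using (Unique)
import Data.List.Relation.Unary.Unique.Propositional.Properties as Unique
open import Data.Nat using (ℕ; zero; suc; _+_; _*_; _∸_; _^_; _<_; _≤_; z≤n; s≤s; z<s; s<s; NonZero; >-nonZero; >-nonZero⁻¹; ≢-nonZero; ≢-nonZero⁻¹)
open import Data.Nat.DivMod using (_%_; _/_; _mod_; m%n<n; m≡m%n+[m/n]*n; %-distribˡ-+; %-distribˡ-*; m%n%n≡m%n; [m+n]%n≡m%n; m<n⇒m%n≡m; m*[n/m]≡n; m*n/n≡m)
open import Data.Nat.Divisibility using (_∣_; _∣?_; divides; quotient≢0; ∣⇒≤; 0∣⇒≡0; m%n≡0⇒n∣m; ∣-trans; ∣-antisym; m∣m*n; ∣n⇒∣m*n; *-pres-∣; *-monoʳ-∣; *-cancelˡ-∣; *-cancelʳ-∣)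
open import Data.Nat.Induction using (<-rec)
open import Data.Nat.Primality using (Prime; prime?; euclidsLemma; prime⇒nonZero; prime⇒irreducible; ¬prime[1])
open import Data.Nat.Primality.Factorisation using (factorise)
import Data.Nat.Properties as ℕ
open import Data.Nat.Tactic.RingSolver using (solve-∀)
open import Data.Product using (∃-syntax; _×_; _,_; proj₂)
open import Data.Sum using (_⊎_; inj₁; inj₂; [_,_]′)
open import Data.Vec using (Vec; []; _∷_; lookup; tabulate; _[_]%=_)
import Data.Vec.Properties as Vec
open import Function using (_∘_)
open import Function.Bundles using (_⇔_; mk⇔; Equivalence)
open import Function.Definitions using (Injective)
open import Relation.Binary.Definitions using (tri<; tri≈; tri>)
open import Relation.Binary.PropositionalEquality using (_≡_; _≢_; refl; sym; trans; cong; cong₂; subst; subst₂; ≢-sym; module ≡-Reasoning)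
open import Relation.Nullary using (¬_; Dec; yes; no; does; contradiction; ¬?; ⌊_⌋)
open import Relation.Nullary.Decidable using (map′; decidable-stable; toWitnessFalse; fromWitnessFalse; _×-dec_)
open import Relation.Unary using (Decidable)

open Equivalence using (to; from)

-- The order of the signed shift

parity : ∀ m → m % 2 ≡ 0 ⊎ m % 2 ≡ 1
parity zero          = inj₁ refl
parity (suc zero)    = inj₂ refl
parity (suc (suc m)) = parity m

even⇒suc-odd : ∀ m → m % 2 ≡ 0 → suc m % 2 ≡ 1
even⇒suc-odd zero          _ = refl
even⇒suc-odd (suc zero)    ()
even⇒suc-odd (suc (suc m)) e = even⇒suc-odd m e

odd⇒suc-even : ∀ m → m % 2 ≡ 1 → suc m % 2 ≡ 0
odd⇒suc-even zero          ()
odd⇒suc-even (suc zero)    _ = refl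
odd⇒suc-even (suc (suc m)) o = odd⇒suc-even m o

suc-odd⇒even : ∀ m → suc m % 2 ≡ 1 → m % 2 ≡ 0
suc-odd⇒even zero          _ = refl
suc-odd⇒even (suc zero)    ()
suc-odd⇒even (suc (suc m)) o = suc-odd⇒even m o

suc-even⇒odd : ∀ m → suc m % 2 ≡ 0 → m % 2 ≡ 1
suc-even⇒odd zero          ()
suc-even⇒odd (suc zero)    _ = refl
suc-even⇒odd (suc (suc m)) e = suc-even⇒odd m e

even≢odd : ∀ {a} → a ≡ 0 → ¬ a ≡ 1
even≢odd refl ()

odd⇒¬suc-odd : ∀ m → m % 2 ≡ 1 → ¬ suc m % 2 ≡ 1
odd⇒¬suc-odd m o = even≢odd (odd⇒suc-even m o)

Agree : ∀ {k} → ℕ → Word k → Word k → Set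
Agree N u v = ∀ i → i < N → u i ≡ v i

infix 4 _≐_
_≐_ : ∀ {k} → Word k → Word k → Set
u ≐ v = ∀ i → u i ≡ v i

tail : ∀ {k} → Word k → Word k
tail u i = u (suc i)

-- s ≺[ σ ] t unfolds to: for some j, s and t agree below j and Differ (minusCount σ s j) (s j) (t j).
Differ : ∀ {k} → ℕ → Fin k → Fin k → Set
Differ c x y = (c % 2 ≡ 0 × x Fin.< y) ⊎ (c % 2 ≡ 1 × y Fin.< x)

Differ-pred : ∀ {k} c {x y : Fin k} → Differ (suc c) x y → Differ c y x
Differ-pred c (inj₁ (e , lt)) = inj₂ (suc-even⇒odd c e , lt)
Differ-pred c (inj₂ (o , gt)) = inj₁ (suc-odd⇒even c o , gt)

module _ {k} (σ : Signs k) where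

  minusCount-cong : ∀ {u v} N → Agree N u v → minusCount σ u N ≡ minusCount σ v N
  minusCount-cong zero    ag = refl
  minusCount-cong (suc N) ag =
    cong₂ _+_ (minusCount-cong N (λ i i<N → ag i (ℕ.m<n⇒m<1+n i<N)))
              (cong (λ x → isMinus (lookup σ x)) (ag N (ℕ.n<1+n N)))

  -- `minusCount` adds letters at the end; comparing words through their tails needs the first
  -- letter split off instead.
  minusCount-suc : ∀ u N → minusCount σ u (suc N) ≡ isMinus (lookup σ (u 0)) + minusCount σ (tail u) N
  minusCount-suc u zero    = ℕ.+-comm 0 _
  minusCount-suc u (suc N) =
    trans (cong (_+ isMinus (lookup σ (u (suc N)))) (minusCount-suc u N))
          (ℕ.+-assoc (isMinus (lookup σ (u 0))) _ _)

  ≺-resp-≐ : ∀ {u u′ v v′} → u ≐ u′ → v ≐ v′ → u ≺[ σ ] v → u′ ≺[ σ ] v′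
  ≺-resp-≐ {u} {u′} {v} {v′} u≐ v≐ (j , ag , d) = j ,
    (λ i i<j → trans (sym (u≐ i)) (trans (ag i i<j) (v≐ i))) ,
    subst₂ (Differ (minusCount σ u′ j)) (u≐ j) (v≐ j)
           (subst (λ c → Differ c (u j) (v j)) (minusCount-cong j (λ i _ → u≐ i)) d)

  ≺-irrefl : ∀ {u v} → u ≐ v → ¬ u ≺[ σ ] v
  ≺-irrefl u≐v (j , _ , inj₁ (_ , lt)) = Fin.<-irrefl (u≐v j) lt
  ≺-irrefl u≐v (j , _ , inj₂ (_ , lt)) = Fin.<-irrefl (sym (u≐v j)) lt

  -- The outer words first differ at the smaller of the two indices. When the indices coincide, so
  -- do the counts before them, and both inequalities point the same way.
  ≺-trans : ∀ {u v w} → u ≺[ σ ] v → v ≺[ σ ] w → u ≺[ σ ] w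
  ≺-trans {u} {v} {w} (j , agj , dj) (k , agk , dk) with ℕ.<-cmp j k
  ... | tri< j<k _ _ = j ,
        (λ i i<j → trans (agj i i<j) (agk i (ℕ.<-trans i<j j<k))) ,
        subst (Differ (minusCount σ u j) (u j)) (agk j j<k) dj
  ... | tri> _ _ k<j = k ,
        (λ i i<k → trans (agj i (ℕ.<-trans i<k k<j)) (agk i i<k)) ,
        subst₂ (λ c x → Differ c x (w k))
               (sym (minusCount-cong k (λ i i<k → agj i (ℕ.<-trans i<k k<j))))
               (sym (agj k k<j)) dk
  ... | tri≈ _ refl _ = j , (λ i i<j → trans (agj i i<j) (agk i i<j)) , combine dj dk
    where
    mc : minusCount σ u j ≡ minusCount σ v j
    mc = minusCount-cong j agj
    combine : Differ (minusCount σ u j) (u j) (v j) → Differ (minusCount σ v j) (v j) (w j) →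
              Differ (minusCount σ u j) (u j) (w j)
    combine (inj₁ (e , p)) (inj₁ (_ , q)) = inj₁ (e , Fin.<-trans p q)
    combine (inj₂ (o , p)) (inj₂ (_ , q)) = inj₂ (o , Fin.<-trans q p)
    combine (inj₁ (e , _)) (inj₂ (o , _)) = contradiction (trans (cong (_% 2) mc) o) (even≢odd e)
    combine (inj₂ (o , _)) (inj₁ (e , _)) = contradiction o (even≢odd (trans (cong (_% 2) mc) e))

  ≺-asym : ∀ {u v} → u ≺[ σ ] v → ¬ v ≺[ σ ] u
  ≺-asym u≺v v≺u = ≺-irrefl (λ _ → refl) (≺-trans u≺v v≺u)

  -- Only a prefix is inspected, since equality of infinite words is undecidable. For shifts of a
  -- word of period `n` the first `n` letters suffice, by `agree⇒≐`.
  ≺-compare : ∀ N u v → Agree N u v ⊎ (u ≺[ σ ] v ⊎ v ≺[ σ ] u)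
  ≺-compare zero    u v = inj₁ λ _ ()
  ≺-compare (suc N) u v with ≺-compare N u v
  ... | inj₂ d  = inj₂ d
  ... | inj₁ ag with Fin.<-cmp (u N) (v N) | parity (minusCount σ u N)
  ...   | tri< lt _ _ | inj₁ e = inj₂ (inj₁ (N , ag , inj₁ (e , lt)))
  ...   | tri< lt _ _ | inj₂ o = inj₂ (inj₂ (N , (λ i i<N → sym (ag i i<N)) ,
          inj₂ (trans (cong (_% 2) (sym (minusCount-cong N ag))) o , lt)))
  ...   | tri> _ _ gt | inj₁ e = inj₂ (inj₂ (N , (λ i i<N → sym (ag i i<N)) ,
          inj₁ (trans (cong (_% 2) (sym (minusCount-cong N ag))) e , gt)))
  ...   | tri> _ _ gt | inj₂ o = inj₂ (inj₁ (N , ag , inj₂ (o , gt)))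
  ...   | tri≈ _ eq _ | _      = inj₁ agree
    where
    agree : Agree (suc N) u v
    agree i i<1+N with ℕ.m<1+n⇒m<n∨m≡n i<1+N
    ... | inj₁ i<N  = ag i i<N
    ... | inj₂ refl = eq

-- The step common to the tent order and to a unimodal map: letters first, then the order of the
-- images, kept (A) on the branch 0 and reversed (B) on the branch 1.
data Fold (x y : Fin 2) (A B : Set) : Set where
  apart : x ≡ 0F → y ≡ 1F → Fold x y A B
  rise  : x ≡ 0F → y ≡ 0F → A → Fold x y A B
  fall  : x ≡ 1F → y ≡ 1F → B → Fold x y A B

Fold-map : ∀ {x y A B C D} → (A → C) → (B → D) → Fold x y A B → Fold x y C D
Fold-map f g (apart p q)  = apart p q
Fold-map f g (rise p q a) = rise p q (f a)
Fold-map f g (fall p q b) = fall p q (g b)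

minusCount-0∷ : ∀ {u} N → u 0 ≡ 0F → minusCount tent u (suc N) ≡ minusCount tent (tail u) N
minusCount-0∷ {u} N u₀ =
  trans (minusCount-suc tent u N) (cong (λ x → isMinus (lookup tent x) + minusCount tent (tail u) N) u₀)

minusCount-1∷ : ∀ {u} N → u 0 ≡ 1F → minusCount tent u (suc N) ≡ suc (minusCount tent (tail u) N)
minusCount-1∷ {u} N u₀ =
  trans (minusCount-suc tent u N) (cong (λ x → isMinus (lookup tent x) + minusCount tent (tail u) N) u₀)

-- Nothing is counted before the first letter, so a difference there decides by the letters alone; a
-- common 0 leaves the parity as it is and a common 1 changes it.
≺-uncons : ∀ {u v} → u ≺[ tent ] v → Fold (u 0) (v 0) (tail u ≺[ tent ] tail v) (tail v ≺[ tent ] tail u)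
≺-uncons {u} {v} (zero , _ , inj₁ (_ , lt)) with u 0 | v 0 | lt
... | 0F | 1F | _      = apart refl refl
... | 1F | 1F | s<s ()
≺-uncons {u} {v} (zero , _ , inj₂ (() , _))
≺-uncons {u} {v} (suc j , ag , d) with u 0 in u₀ | ag 0 z<s
... | 0F | v₀ = rise refl (sym v₀) (j , (λ i i<j → ag (suc i) (s<s i<j)) ,
  subst (λ c → Differ c (u (suc j)) (v (suc j))) (minusCount-0∷ j u₀) d)
... | 1F | v₀ = fall refl (sym v₀) (j , (λ i i<j → sym (ag (suc i) (s<s i<j))) ,
  Differ-pred (minusCount tent (tail v) j)
    (subst (λ c → Differ c (u (suc j)) (v (suc j)))
      (trans (minusCount-1∷ j u₀) (cong suc (minusCount-cong tent j (λ i i<j → ag (suc i) (s<s i<j))))) d))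

-- Periods of periodic words

least : ∀ {P : ℕ → Set} → Decidable P → ∀ n → P n → ∃[ m ] (P m × (∀ {k} → k < m → ¬ P k))
least {P} P? = <-rec _ search
  where
  search : ∀ n → (∀ {m} → m < n → P m → ∃[ m ] (P m × (∀ {k} → k < m → ¬ P k))) →
           P n → ∃[ m ] (P m × (∀ {k} → k < m → ¬ P k))
  search n rec Pn with ℕ.anyUpTo? P? n
  ... | yes (m , m<n , Pm) = rec m<n Pm
  ... | no ¬any            = n , Pn , λ k<n Pk → ¬any (_ , k<n , Pk)

module _ {n} .{{_ : NonZero n}} where

  toℕ-mod : ∀ i → toℕ (i mod n) ≡ i % n
  toℕ-mod i = Fin.toℕ-fromℕ< (m%n<n i n)

  mod-cong : ∀ {i j} → i % n ≡ j % n → i mod n ≡ j mod n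
  mod-cong eq = Fin.toℕ-injective (trans (toℕ-mod _) (trans eq (sym (toℕ-mod _))))

  mod-toℕ : ∀ (i : Fin n) → toℕ i mod n ≡ i
  mod-toℕ i = Fin.toℕ-injective (trans (toℕ-mod _) (m<n⇒m%n≡m (Fin.toℕ<n i)))

  toℕ-mod-< : ∀ {p} → p < n → toℕ (p mod n) ≡ p
  toℕ-mod-< p<n = trans (toℕ-mod _) (m<n⇒m%n≡m p<n)

  %-+-congʳ : ∀ c {i j} → i % n ≡ j % n → (c + i) % n ≡ (c + j) % n
  %-+-congʳ c {i} {j} eq = begin
    (c + i) % n          ≡⟨ %-distribˡ-+ c i n ⟩
    (c % n + i % n) % n  ≡⟨ cong (λ x → (c % n + x) % n) eq ⟩
    (c % n + j % n) % n  ≡⟨ %-distribˡ-+ c j n ⟨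
    (c + j) % n          ∎
    where open ≡-Reasoning

  n+m%n : ∀ m → (n + m) % n ≡ m % n
  n+m%n m = trans (cong (_% n) (ℕ.+-comm n m)) ([m+n]%n≡m%n m n)

Period : ∀ {k} → Word k → ℕ → Set
Period s d = ∀ i → s (d + i) ≡ s i

module _ {k} {s : Word k} where

  period-+ : ∀ {c d} → Period s c → Period s d → Period s (c + d)
  period-+ {c} {d} pc pd i = trans (cong s (ℕ.+-assoc c d i)) (trans (pc (d + i)) (pd i))

  period-* : ∀ {d} m → Period s d → Period s (m * d)
  period-* zero    pd i = refl
  period-* (suc m) pd   = period-+ pd (period-* m pd)

  period-cancel : ∀ {c d} → Period s d → Period s (d + c) → Period s c
  period-cancel {c} {d} pd pdc i =
    trans (sym (pd (c + i))) (trans (cong s (sym (ℕ.+-assoc d c i))) (pdc i))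

  period-% : ∀ {m p} .{{_ : NonZero p}} → Period s p → Period s m → Period s (m % p)
  period-% {m} {p} pp pm = period-cancel (period-* (m / p) pp)
    (subst (Period s) (trans (m≡m%n+[m/n]*n m p) (ℕ.+-comm (m % p) _)) pm)

module _ {k n} .{{_ : NonZero n}} (b : Vec (Fin k) n) where

  periodic-cong : ∀ {i j} → i % n ≡ j % n → periodic b i ≡ periodic b j
  periodic-cong eq = cong (lookup b) (mod-cong eq)

  periodic-toℕ : ∀ i → periodic b (toℕ i) ≡ lookup b i
  periodic-toℕ i = cong (lookup b) (mod-toℕ i)

  period-length : Period (periodic b) n
  period-length i = periodic-cong (n+m%n i)

  shift-% : ∀ p → shiftⁿ (p % n) (periodic b) ≐ shiftⁿ p (periodic b)
  shift-% p i = periodic-cong (begin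
    (p % n + i) % n  ≡⟨ cong (_% n) (ℕ.+-comm (p % n) i) ⟩
    (i + p % n) % n  ≡⟨ %-+-congʳ i (m%n%n≡m%n p n) ⟩
    (i + p) % n      ≡⟨ cong (_% n) (ℕ.+-comm i p) ⟩
    (p + i) % n      ∎)
    where open ≡-Reasoning

  agree⇒≐ : ∀ {p q} → Agree n (shiftⁿ p (periodic b)) (shiftⁿ q (periodic b)) →
            shiftⁿ p (periodic b) ≐ shiftⁿ q (periodic b)
  agree⇒≐ {p} {q} ag i = begin
    periodic b (p + i)      ≡⟨ periodic-cong (%-+-congʳ p (sym (m%n%n≡m%n i n))) ⟩
    periodic b (p + i % n)  ≡⟨ ag (i % n) (m%n<n i n) ⟩
    periodic b (q + i % n)  ≡⟨ periodic-cong (%-+-congʳ q (m%n%n≡m%n i n)) ⟩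
    periodic b (q + i)      ∎
    where open ≡-Reasoning

  period? : Decidable (Period (periodic b))
  period? d = map′ (λ all → agree⇒≐ {d} {0} (λ _ i<n → all i<n)) (λ per {i} _ → per i)
    (ℕ.allUpTo? (λ i → periodic b (d + i) Fin.≟ periodic b i) n)

  -- The remainder of a period on division by the least positive one is again a period, smaller than
  -- the least, hence 0.
  minimalPeriod : ∃[ p ] (NonZero p × Period (periodic b) p × (∀ m → Period (periodic b) m → p ∣ m))
  -- The search is over `suc d` because 0 is trivially a period; the length `n` is `suc (n ∸ 1)`.
  minimalPeriod with least (λ d → period? (suc d)) (n ∸ 1)
      (subst (Period (periodic b)) (sym (ℕ.suc-pred n)) period-length)
  ... | d , per , min = suc d , _ , per , divides′
    where
    divides′ : ∀ m → Period (periodic b) m → suc d ∣ m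
    divides′ m pm with m % suc d in eq | m%n<n m (suc d) | period-% {p = suc d} per pm
    ... | zero  | _       | _  = m%n≡0⇒n∣m m (suc d) eq
    ... | suc r | s<s r<d | pr = contradiction pr (min r<d)

  -- Primitivity excludes as periods the proper divisors of `n`. The least period divides `n`, so it
  -- equals `n`, and it divides all other periods.
  primitive⇒∣ : Primitive b → ∀ m → Period (periodic b) m → n ∣ m
  primitive⇒∣ prim m pm with minimalPeriod
  ... | p , _ , pp , min with ℕ.m≤n⇒m<n∨m≡n (∣⇒≤ (min n period-length))
  ...   | inj₁ p<n  = contradiction (p , p<n , min n period-length , pp) prim
  ...   | inj₂ refl = min m pm

  ∣⇒primitive : (∀ m → Period (periodic b) m → n ∣ m) → Primitive b
  ∣⇒primitive n∣ (zero , 0<n , 0∣n , _) = contradiction (0∣⇒≡0 0∣n) (≢-nonZero⁻¹ n)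
  ∣⇒primitive n∣ (suc d , d<n , _ , per) = ℕ.<⇒≱ d<n (∣⇒≤ (n∣ (suc d) per))

  -- Continuing both shifts by the remaining `n ∸ p` letters turns the first into a shift by the
  -- full length, which is no shift.
  shifts-agree⇒period : ∀ {p c} → p ≤ n → shiftⁿ p (periodic b) ≐ shiftⁿ (p + c) (periodic b) →
                        Period (periodic b) c
  shifts-agree⇒period {p} {c} p≤n eq m = begin
    s (c + m)                  ≡⟨ period-length (c + m) ⟨
    s (n + (c + m))            ≡⟨ cong (λ x → s (x + (c + m))) (ℕ.m+[n∸m]≡n p≤n) ⟨
    s (p + r + (c + m))        ≡⟨ cong s (regroup p r c m) ⟩
    s (p + c + (r + m))        ≡⟨ eq (r + m) ⟨
    s (p + (r + m))            ≡⟨ cong s (ℕ.+-assoc p r m) ⟨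
    s (p + r + m)              ≡⟨ cong (λ x → s (x + m)) (ℕ.m+[n∸m]≡n p≤n) ⟩
    s (n + m)                  ≡⟨ period-length m ⟩
    s m                        ∎
    where
    open ≡-Reasoning
    s = periodic b
    r = n ∸ p
    regroup : ∀ p r c m → p + r + (c + m) ≡ p + c + (r + m)
    regroup = solve-∀

  primitive⇒shifts-≢ : Primitive b → ∀ {p q} → p < q → q < n →
                       ¬ (shiftⁿ p (periodic b) ≐ shiftⁿ q (periodic b))
  primitive⇒shifts-≢ prim {p} {q} p<q q<n eq = ℕ.<⇒≱ (ℕ.≤-<-trans (ℕ.m∸n≤m q p) q<n)
    (∣⇒≤ {{>-nonZero (ℕ.m<n⇒0<n∸m p<q)}} (primitive⇒∣ prim (q ∸ p)
      (shifts-agree⇒period (ℕ.<⇒≤ (ℕ.<-trans p<q q<n))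
        (λ i → trans (eq i) (cong (λ x → periodic b (x + i)) (sym (ℕ.m+[n∸m]≡n (ℕ.<⇒≤ p<q))))))))

-- Patterns and unimodal orbits

-- R p is the position of the p-th point of an orbit of a unimodal map, and s is its itinerary.
Unimodal : Word 2 → (ℕ → ℕ) → Set
Unimodal s R = ∀ p q → R p < R q → Fold (s p) (s q) (R (suc p) < R (suc q)) (R (suc q) < R (suc p))

Fold⇒≯ : ∀ {x y A B} → Fold x y A B → ¬ y Fin.< x
Fold⇒≯ (apart refl refl) ()
Fold⇒≯ (rise refl refl _) ()
Fold⇒≯ (fall refl refl _) (s≤s ())

Fold-≡ : ∀ {x y A B} → x ≡ y → Fold x y A B → (x ≡ 0F × A) ⊎ (x ≡ 1F × B)
Fold-≡ refl (apart p q) with trans (sym p) q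
... | ()
Fold-≡ _    (rise p _ a)  = inj₁ (p , a)
Fold-≡ _    (fall p _ b)  = inj₂ (p , b)

module _ {s : Word 2} {R : ℕ → ℕ} (uni : Unimodal s R) where

  -- Induction along the common prefix: each common 0 keeps the order of the two points and each
  -- common 1 reverses it.
  agree⇒order : ∀ N {p q} → R p < R q → Agree N (shiftⁿ p s) (shiftⁿ q s) →
          let c = minusCount tent (shiftⁿ p s) N in
          (c % 2 ≡ 0 × R (p + N) < R (q + N)) ⊎ (c % 2 ≡ 1 × R (q + N) < R (p + N))
  agree⇒order zero    {p} {q} lt ag =
    inj₁ (refl , subst₂ (λ x y → R x < R y) (sym (ℕ.+-identityʳ p)) (sym (ℕ.+-identityʳ q)) lt)
  agree⇒order (suc N) {p} {q} lt ag
    rewrite ℕ.+-suc p N | ℕ.+-suc q N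
    with agree⇒order N lt (λ i i<N → ag i (ℕ.m<n⇒m<1+n i<N)) | ag N (ℕ.n<1+n N)
  ... | inj₁ (e , lt′) | eq with Fold-≡ eq (uni _ _ lt′)
  ...   | inj₁ (x₀ , r) rewrite x₀ | ℕ.+-comm (minusCount tent (shiftⁿ p s) N) 0 = inj₁ (e , r)
  ...   | inj₂ (x₁ , r) rewrite x₁ | ℕ.+-comm (minusCount tent (shiftⁿ p s) N) 1 =
          inj₂ (even⇒suc-odd (minusCount tent (shiftⁿ p s) N) e , r)
  agree⇒order (suc N) {p} {q} lt ag | inj₂ (o , gt′) | eq with Fold-≡ (sym eq) (uni _ _ gt′)
  ...   | inj₁ (x₀ , r) rewrite trans eq x₀ | ℕ.+-comm (minusCount tent (shiftⁿ p s) N) 0 = inj₂ (o , r)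
  ...   | inj₂ (x₁ , r) rewrite trans eq x₁ | ℕ.+-comm (minusCount tent (shiftⁿ p s) N) 1 =
          inj₁ (odd⇒suc-even (minusCount tent (shiftⁿ p s) N) o , r)

  -- At the first difference `agree⇒order` tells which point is on the left, and a point with letter
  -- 1 is never to the left of one with letter 0. The opposite tent comparison would require exactly
  -- that.
  unimodal⇒⊀ : ∀ p q → R p < R q → ¬ shiftⁿ q s ≺[ tent ] shiftⁿ p s
  unimodal⇒⊀ p q lt (j , ag , d)
    with agree⇒order j lt (λ i i<j → sym (ag i i<j))
       | subst (λ c → Differ c (s (q + j)) (s (p + j))) (minusCount-cong tent j ag) d
  ... | inj₁ (e , lt′) | inj₁ (_ , l) = Fold⇒≯ (uni _ _ lt′) l
  ... | inj₁ (e , lt′) | inj₂ (o , _) = even≢odd e o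
  ... | inj₂ (o , gt′) | inj₁ (e , _) = even≢odd e o
  ... | inj₂ (o , gt′) | inj₂ (_ , l) = Fold⇒≯ (uni _ _ gt′) l

  -- Two points with the same itinerary of odd parity over one period would exchange their order.
  odd⇒¬agree : ∀ {n p q} → (∀ p → R (p + n) ≡ R p) → minusCount tent (shiftⁿ p s) n % 2 ≡ 1 →
               R p < R q → ¬ Agree n (shiftⁿ p s) (shiftⁿ q s)
  odd⇒¬agree {n} {p} {q} perR odd lt ag with agree⇒order n lt ag
  ... | inj₁ (e , _)  = even≢odd e odd
  ... | inj₂ (_ , gt) = ℕ.<-asym lt (subst₂ _<_ (perR q) (perR p) gt)

-- If both letters changed, 00 would become 11 or conversely, and the images would be both ordered
-- and reversed. So two itineraries of one orbit differ in at most one point.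
itineraries-≡ : ∀ {s s′ R p q} → Unimodal s R → Unimodal s′ R → R p < R q → s p ≡ s′ p ⊎ s q ≡ s′ q
itineraries-≡ uni uni′ lt with uni _ _ lt | uni′ _ _ lt
... | apart x y  | apart x′ y′  = inj₁ (trans x (sym x′))
... | apart x y  | rise x′ _ _  = inj₁ (trans x (sym x′))
... | apart x y  | fall _ y′ _  = inj₂ (trans y (sym y′))
... | rise x _ _ | apart x′ _   = inj₁ (trans x (sym x′))
... | rise x _ _ | rise x′ _ _  = inj₁ (trans x (sym x′))
... | rise _ _ a | fall _ _ b   = contradiction b (ℕ.<-asym a)
... | fall _ y _ | apart _ y′   = inj₂ (trans y (sym y′))
... | fall _ _ b | rise _ _ a   = contradiction b (ℕ.<-asym a)
... | fall _ y _ | fall _ y′ _  = inj₂ (trans y (sym y′))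

-- D holds at the indices of the point mapped to the maximum, whose letter may be chosen freely.
flip-unimodal : ∀ {s s′ R} {D : ℕ → Set} → Decidable D →
  (∀ {p} → D p → s′ p ≡ opposite (s p)) → (∀ {p} → ¬ D p → s′ p ≡ s p) →
  (∀ {p q} → D p → D q → R p ≡ R q) → (∀ {p q} → ¬ D p → D q → R (suc p) < R (suc q)) →
  Unimodal s R → Unimodal s′ R
flip-unimodal D? flipped same D-≡ peak uni p q lt with D? p | D? q
... | yes dp | yes dq = contradiction (D-≡ dp dq) (ℕ.<⇒≢ lt)
... | no ¬dp | no ¬dq rewrite same ¬dp | same ¬dq = uni p q lt
-- The peak point `p` is on the left and its image is the larger one: the letters are 0, 1 or 1, 1,
-- and flipping the first exchanges these cases. With the peak on the right they are 0, 0 or 0, 1.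
... | yes dp | no ¬dq rewrite flipped dp | same ¬dq with uni p q lt
...   | apart x y  = fall (cong opposite x) y (peak ¬dq dp)
...   | rise _ _ a = contradiction a (ℕ.<-asym (peak ¬dq dp))
...   | fall x y _ = apart (cong opposite x) y
flip-unimodal D? flipped same D-≡ peak uni p q lt | no ¬dp | yes dq
  rewrite same ¬dp | flipped dq with uni p q lt
...   | apart x y  = rise x (cong opposite y) (peak ¬dp dq)
...   | rise x y _ = apart x (cong opposite y)
...   | fall _ _ b = contradiction b (ℕ.<-asym (peak ¬dp dq))

-- The parity of the number of 1s

letters-differ : ∀ (x y : Fin 2) → x ≢ y → (x ≡ 0F × y ≡ 1F) ⊎ (x ≡ 1F × y ≡ 0F)
letters-differ 0F 0F ne = contradiction refl ne
letters-differ 0F 1F ne = inj₁ (refl , refl)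
letters-differ 1F 0F ne = inj₂ (refl , refl)
letters-differ 1F 1F ne = contradiction refl ne

opposite-≢ : ∀ (x : Fin 2) → opposite x ≢ x
opposite-≢ 0F ()
opposite-≢ 1F ()

-- A single changed letter adds or removes one 1, and so changes the parity.
minusCount-differ : ∀ {u v : Word 2} {p} N → p < N → u p ≢ v p → (∀ q → q < N → q ≢ p → u q ≡ v q) →
  suc (minusCount tent u N) ≡ minusCount tent v N ⊎ minusCount tent u N ≡ suc (minusCount tent v N)
minusCount-differ {u} {v} (suc N) p<1+N ne same with ℕ.m<1+n⇒m<n∨m≡n p<1+N
... | inj₁ p<N rewrite same N (ℕ.n<1+n N) (≢-sym (ℕ.<⇒≢ p<N))
  with minusCount-differ N p<N ne (λ q q<N → same q (ℕ.m<n⇒m<1+n q<N))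
... | inj₁ eq = inj₁ (cong (_+ isMinus (lookup tent (v N))) eq)
... | inj₂ eq = inj₂ (cong (_+ isMinus (lookup tent (v N))) eq)
minusCount-differ {u} {v} (suc N) p<1+N ne same | inj₂ refl
  with letters-differ (u N) (v N) ne
     | minusCount-cong tent {u} {v} N (λ q q<N → same q (ℕ.m<n⇒m<1+n q<N) (ℕ.<⇒≢ q<N))
... | inj₁ (x , y) | mc rewrite x | y | mc = inj₁ (trans (cong suc (ℕ.+-identityʳ _)) (ℕ.+-comm 1 _))
... | inj₂ (x , y) | mc rewrite x | y | mc = inj₂ (trans (ℕ.+-comm _ 1) (cong suc (sym (ℕ.+-identityʳ _))))

-- Moving the window one step drops the letter at `p` and takes in the letter at `p + n`, which is
-- the same.
minusCount-rotate : ∀ {k} (σ : Signs k) {s : Word k} {n} → Period s n → ∀ p →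
                    minusCount σ (shiftⁿ p s) n ≡ minusCount σ s n
minusCount-rotate σ {s} {n} per zero    = refl
minusCount-rotate σ {s} {n} per (suc p) = trans (ℕ.+-cancelˡ-≡ (m (s p)) _ _ step) (minusCount-rotate σ per p)
  where
  open ≡-Reasoning
  m = λ x → isMinus (lookup σ x)
  step : m (s p) + minusCount σ (shiftⁿ (suc p) s) n ≡ m (s p) + minusCount σ (shiftⁿ p s) n
  step = begin
    m (s p) + minusCount σ (shiftⁿ (suc p) s) n
      ≡⟨ cong₂ _+_ (cong (λ x → m (s x)) (sym (ℕ.+-identityʳ p)))
                   (minusCount-cong σ n (λ i _ → cong s (sym (ℕ.+-suc p i)))) ⟩
    m (s (p + 0)) + minusCount σ (tail (shiftⁿ p s)) n
      ≡⟨ minusCount-suc σ (shiftⁿ p s) n ⟨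
    minusCount σ (shiftⁿ p s) n + m (s (p + n))
      ≡⟨ cong (λ x → minusCount σ (shiftⁿ p s) n + m x) (trans (cong s (ℕ.+-comm p n)) (per p)) ⟩
    minusCount σ (shiftⁿ p s) n + m (s p)
      ≡⟨ ℕ.+-comm _ (m (s p)) ⟩
    m (s p) + minusCount σ (shiftⁿ p s) n ∎

argmax : ∀ (f : ℕ → ℕ) N → ∃[ m ] (∀ j → j < suc N → f j ≤ f m)
argmax f zero    = 0 , λ { zero _ → ℕ.≤-refl ; (suc _) (s≤s ()) }
argmax f (suc N) with argmax f N
... | m , max with ℕ.≤-total (f m) (f (suc N))
...   | inj₁ le = suc N , λ j j< → [ (λ j<N → ℕ.≤-trans (max j j<N) le) , (λ { refl → ℕ.≤-refl }) ]′ (ℕ.m<1+n⇒m<n∨m≡n j<)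
...   | inj₂ ge = m , λ j j< → [ max j , (λ { refl → ge }) ]′ (ℕ.m<1+n⇒m<n∨m≡n j<)

-- A value `y` that is not attained could be punched out, leaving an injection into a smaller set.
injective⇒surjective : ∀ {n} {f : Fin n → Fin n} → Injective _≡_ _≡_ f → ∀ y → ∃[ x ] f x ≡ y
injective⇒surjective {suc n} {f} inj y with Fin.any? (λ x → f x Fin.≟ y)
... | yes ∃x = ∃x
... | no ¬∃x = contradiction (Fin.injective⇒≤ {f = λ x → punchOut (λ eq → ¬∃x (x , sym eq))}
                 (λ {x} {x′} eq → inj (Fin.punchOut-injective (λ e → ¬∃x (x , sym e)) (λ e → ¬∃x (x′ , sym e)) eq))) ℕ.1+n≰n

module _ {A : Set} {P Q : A → Set} (P? : Decidable P) (Q? : Decidable Q) (P⊆Q : ∀ {x} → P x → Q x) where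

  length-filter-mono : ∀ xs → length (filter P? xs) ≤ length (filter Q? xs)
  length-filter-mono []       = z≤n
  length-filter-mono (x ∷ xs) with P? x | Q? x
  ... | yes _  | yes _  = s≤s (length-filter-mono xs)
  ... | yes px | no ¬qx = contradiction (P⊆Q px) ¬qx
  ... | no _   | yes _  = ℕ.m≤n⇒m≤1+n (length-filter-mono xs)
  ... | no _   | no _   = length-filter-mono xs

  length-filter-strict : ∀ {x xs} → x ∈ xs → Q x → ¬ P x → length (filter P? xs) < length (filter Q? xs)
  length-filter-strict {x} {_ ∷ xs} (here refl) qx ¬px with P? x | Q? x
  ... | yes px | _      = contradiction px ¬px
  ... | no _   | yes _  = s≤s (length-filter-mono xs)
  ... | no _   | no ¬qx = contradiction qx ¬qx
  length-filter-strict {_} {y ∷ xs} (there x∈) qx ¬px with P? y | Q? y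
  ... | yes _  | yes _  = s≤s (length-filter-strict x∈ qx ¬px)
  ... | yes py | no ¬qy = contradiction (P⊆Q py) ¬qy
  ... | no _   | yes _  = ℕ.m≤n⇒m≤1+n (length-filter-strict x∈ qx ¬px)
  ... | no _   | no _   = length-filter-strict x∈ qx ¬px

lookup-ext : ∀ {A : Set} {n} {xs ys : Vec A n} → (∀ i → lookup xs i ≡ lookup ys i) → xs ≡ ys
lookup-ext {xs = xs} {ys} eq =
  trans (sym (Vec.tabulate∘lookup xs)) (trans (Vec.tabulate-cong eq) (Vec.tabulate∘lookup ys))

-- Odd words and their patterns

module _ {n} .{{_ : NonZero n}} where

  Odd : Vec (Fin 2) n → Set
  Odd b = minusCount tent (periodic b) n % 2 ≡ 1

  -- Extended periodically to all natural indices, so that the passage from the last point back to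
  -- the first needs no separate case.
  position : Vec (Fin n) n → ℕ → ℕ
  position π p = toℕ (lookup π (p mod n))

  module _ (π : Vec (Fin n) n) where

    position-cong : ∀ {p q} → p % n ≡ q % n → position π p ≡ position π q
    position-cong eq = cong (λ i → toℕ (lookup π i)) (mod-cong eq)

    position-toℕ : ∀ i → position π (toℕ i) ≡ toℕ (lookup π i)
    position-toℕ i = cong (λ i → toℕ (lookup π i)) (mod-toℕ i)

    position-injective : Injective _≡_ _≡_ (lookup π) → ∀ {p q} → position π p ≡ position π q → p mod n ≡ q mod n
    position-injective inj eq = inj (Fin.toℕ-injective eq)

  -- The pattern translates positions into the tent order, `≺-uncons` passes to the tails, which are
  -- the next shifts, and the pattern translates back.
  pattern⇒unimodal : ∀ b π → IsPatternOf tent b π → Unimodal (periodic b) (position π)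
  pattern⇒unimodal b π (_ , iff) p q lt =
    subst₂ (λ x y → Fold (s x) (s y) (position π (suc p) < position π (suc q)) (position π (suc q) < position π (suc p)))
      (ℕ.+-identityʳ p) (ℕ.+-identityʳ q)
      (Fold-map (onTails (from (order (suc p) (suc q)))) (onTails (from (order (suc q) (suc p))))
        (≺-uncons (to (order p q) lt)))
    where
    s = periodic b
    shift-mod : ∀ p → shiftⁿ (toℕ (p mod n)) s ≐ shiftⁿ p s
    shift-mod p i = trans (cong (λ x → s (x + i)) (toℕ-mod p)) (shift-% b p i)
    order : ∀ p q → position π p < position π q ⇔ (shiftⁿ p s ≺[ tent ] shiftⁿ q s)
    order p q = mk⇔
      (λ lt → ≺-resp-≐ tent (shift-mod p) (shift-mod q) (to (iff (p mod n) (q mod n)) lt))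
      (λ lt → from (iff (p mod n) (q mod n)) (≺-resp-≐ tent (λ i → sym (shift-mod p i)) (λ i → sym (shift-mod q i)) lt))
    onTails : ∀ {p q} {A : Set} → ((shiftⁿ (suc p) s ≺[ tent ] shiftⁿ (suc q) s) → A) →
              tail (shiftⁿ p s) ≺[ tent ] tail (shiftⁿ q s) → A
    onTails {p} {q} f lt = f (≺-resp-≐ tent (λ i → cong s (ℕ.+-suc p i)) (λ i → cong s (ℕ.+-suc q i)) lt)

  -- The shifts cannot be in the opposite order, and they cannot agree over a full period since the
  -- number of 1s is odd.
  odd-unimodal⇒≺ : ∀ b π → Odd b → Unimodal (periodic b) (position π) →
    ∀ p q → position π p < position π q → shiftⁿ p (periodic b) ≺[ tent ] shiftⁿ q (periodic b)
  odd-unimodal⇒≺ b π odd uni p q lt with ≺-compare tent n (shiftⁿ p (periodic b)) (shiftⁿ q (periodic b))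
  ... | inj₂ (inj₁ p≺q) = p≺q
  ... | inj₂ (inj₂ q≺p) = contradiction q≺p (unimodal⇒⊀ uni p q lt)
  ... | inj₁ ag = contradiction ag (odd⇒¬agree uni
        (λ p → position-cong π (trans (cong (_% n) (ℕ.+-comm p n)) (n+m%n p)))
        (trans (cong (_% 2) (minusCount-rotate tent (period-length b) p)) odd) lt)

  odd-unimodal⇒pattern : ∀ b π → Injective _≡_ _≡_ (lookup π) → Odd b → Unimodal (periodic b) (position π) →
                         Primitive b × IsPatternOf tent b π
  odd-unimodal⇒pattern b π inj odd uni = prim , inj , λ i j → mk⇔
    (λ lt → odd-unimodal⇒≺ b π odd uni _ _ (subst₂ _<_ (sym (position-toℕ π i)) (sym (position-toℕ π j)) lt))
    (reflect i j)
    where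
    reflect : ∀ i j → shiftⁿ (toℕ i) (periodic b) ≺[ tent ] shiftⁿ (toℕ j) (periodic b) → lookup π i Fin.< lookup π j
    reflect i j i≺j with Fin.<-cmp (lookup π i) (lookup π j)
    ... | tri< lt _ _ = lt
    ... | tri≈ _ eq _ = contradiction i≺j (≺-irrefl tent (λ m → cong (λ x → shiftⁿ (toℕ x) (periodic b) m) (inj eq)))
    ... | tri> _ _ gt = contradiction i≺j
      (unimodal⇒⊀ uni _ _ (subst₂ _<_ (sym (position-toℕ π j)) (sym (position-toℕ π i)) gt))
    -- A proper period `d` would make the shifts by `d` and by 0 equal, while different positions
    -- make them strictly ordered. Equal positions leave `d ≡ 0`, and 0 does not divide `n`.
    prim : Primitive b
    prim (d , d<n , d∣n , per) with ℕ.<-cmp (position π d) (position π 0)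
    ... | tri< lt _ _ = ≺-irrefl tent per (odd-unimodal⇒≺ b π odd uni d 0 lt)
    ... | tri> _ _ gt = ≺-irrefl tent (λ i → sym (per i)) (odd-unimodal⇒≺ b π odd uni 0 d gt)
    ... | tri≈ _ eq _ = ≢-nonZero⁻¹ n (0∣⇒≡0 (subst (_∣ n) d≡0 d∣n))
      where
      d≡0 : d ≡ 0
      d≡0 = trans (sym (toℕ-mod-< d<n)) (trans (cong toℕ (position-injective π inj eq)) (toℕ-mod-< (>-nonZero⁻¹ n)))

  flipAt : Fin n → Vec (Fin 2) n → Vec (Fin 2) n
  flipAt i b = b [ i ]%= opposite

  flipAt-≡ : ∀ i b {p} → p mod n ≡ i → periodic (flipAt i b) p ≡ opposite (periodic b p)
  flipAt-≡ i b refl = Vec.lookup∘updateAt i b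

  flipAt-≢ : ∀ i b {p} → p mod n ≢ i → periodic (flipAt i b) p ≡ periodic b p
  flipAt-≢ i b ne = Vec.lookup∘updateAt′ _ i ne b

  flipAt-parity : ∀ i b → let c = minusCount tent (periodic b) n; c′ = minusCount tent (periodic (flipAt i b)) n in
                  suc c ≡ c′ ⊎ c ≡ suc c′
  flipAt-parity i b = minusCount-differ {p = toℕ i} n (Fin.toℕ<n i)
    (λ eq → opposite-≢ (periodic b (toℕ i)) (sym (trans eq (flipAt-≡ i b (mod-toℕ i)))))
    (λ q q<n q≢i → sym (flipAt-≢ i b (λ eq → q≢i (trans (sym (toℕ-mod-< q<n)) (cong toℕ eq)))))

  flipAt-odd : ∀ i b → ¬ Odd b → Odd (flipAt i b)
  flipAt-odd i b ¬odd with flipAt-parity i b | parity (minusCount tent (periodic b) n)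
  ... | _       | inj₂ o = contradiction o ¬odd
  ... | inj₁ eq | inj₁ e = trans (cong (_% 2) (sym eq)) (even⇒suc-odd (minusCount tent (periodic b) n) e)
  ... | inj₂ eq | inj₁ e = suc-even⇒odd (minusCount tent (periodic (flipAt i b)) n) (trans (cong (_% 2) (sym eq)) e)

  flipAt-even : ∀ i b → Odd b → ¬ Odd (flipAt i b)
  flipAt-even i b o o′ with flipAt-parity i b
  ... | inj₁ eq = odd⇒¬suc-odd (minusCount tent (periodic b) n) o (trans (cong (_% 2) eq) o′)
  ... | inj₂ eq = odd⇒¬suc-odd (minusCount tent (periodic (flipAt i b)) n) o′ (trans (cong (_% 2) (sym eq)) o)

  -- Flipping the letter of the point mapped to the maximum changes the parity but keeps the
  -- itinerary unimodal, and then `odd-unimodal⇒pattern` applies.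
  even-pattern⇒odd-pattern : ∀ b π → ¬ Odd b → IsPatternOf tent b π →
                             ∃[ b′ ] (Odd b′ × Primitive b′ × IsPatternOf tent b′ π)
  even-pattern⇒odd-pattern b π even pat@(inj , _) with argmax (position π) (n ∸ 1)
  ... | m , max = flipAt i b , odd , odd-unimodal⇒pattern (flipAt i b) π inj odd
      (flip-unimodal (λ p → p mod n Fin.≟ i) (flipAt-≡ i b) (flipAt-≢ i b)
        (λ dp dq → cong (λ i → toℕ (lookup π i)) (trans dp (sym dq))) peak (pattern⇒unimodal b π pat))
    where
    r = n ∸ 1
    -- The cyclic predecessor of the index `m` of the maximum; adding `n ∸ 1` replaces subtracting
    -- 1.
    i : Fin n
    i = (r + m) mod n
    odd : Odd (flipAt i b)
    odd = flipAt-odd i b even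
    1+r≡n : suc r ≡ n
    1+r≡n = ℕ.suc-pred n
    fromMod : ∀ {p q} → p mod n ≡ q mod n → p % n ≡ q % n
    fromMod eq = trans (sym (toℕ-mod _)) (trans (cong toℕ eq) (toℕ-mod _))
    max′ : ∀ p → position π p ≤ position π m
    max′ p = subst (_≤ position π m) (position-cong π (m%n%n≡m%n p n))
      (max (p % n) (subst (p % n <_) (sym 1+r≡n) (m%n<n p n)))
    suc-D : ∀ {q} → q mod n ≡ i → suc q % n ≡ m % n
    suc-D {q} dq = trans (%-+-congʳ 1 (fromMod dq)) (trans (cong (λ x → (x + m) % n) 1+r≡n) (n+m%n m))
    peak : ∀ {p q} → ¬ p mod n ≡ i → q mod n ≡ i → position π (suc p) < position π (suc q)
    peak {p} {q} ¬dp dq = ℕ.≤∧≢⇒< (subst (position π (suc p) ≤_) (sym (position-cong π (suc-D dq))) (max′ (suc p)))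
      -- Adding `r` undoes the successor: if the images were equal, `p` would be congruent to the
      -- index `i`.
      (λ eq → ¬dp (mod-cong (begin
        p % n            ≡⟨ n+m%n p ⟨
        (n + p) % n      ≡⟨ cong (_% n) (trans (cong (_+ p) (sym 1+r≡n)) (sym (ℕ.+-suc r p))) ⟩
        (r + suc p) % n  ≡⟨ %-+-congʳ r (trans (fromMod (position-injective π inj eq)) (suc-D dq)) ⟩
        (r + m) % n      ∎)))
      where open ≡-Reasoning

  -- By `itineraries-≡` the two words differ in at most one letter, and a difference in exactly one
  -- would change the parity.
  odd-pattern-injective : ∀ b b′ π → Odd b → Odd b′ → IsPatternOf tent b π → IsPatternOf tent b′ π → b ≡ b′
  odd-pattern-injective b b′ π o o′ pat@(inj , _) pat′ with Fin.any? (λ i → ¬? (lookup b i Fin.≟ lookup b′ i))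
  ... | no ¬diff = lookup-ext (λ i → decidable-stable (lookup b i Fin.≟ lookup b′ i) (λ ne → ¬diff (i , ne)))
  ... | yes (i , ne) = contradiction
        (minusCount-differ {p = toℕ i} n (Fin.toℕ<n i) ne′ same)
        [ (λ eq → odd⇒¬suc-odd (minusCount tent (periodic b) n) o (trans (cong (_% 2) eq) o′))
        , (λ eq → odd⇒¬suc-odd (minusCount tent (periodic b′) n) o′ (trans (cong (_% 2) (sym eq)) o)) ]′
    where
    uni = pattern⇒unimodal b π pat
    uni′ = pattern⇒unimodal b′ π pat′
    ne′ : periodic b (toℕ i) ≢ periodic b′ (toℕ i)
    ne′ eq = ne (trans (sym (periodic-toℕ b i)) (trans eq (periodic-toℕ b′ i)))
    same : ∀ q → q < n → q ≢ toℕ i → periodic b q ≡ periodic b′ q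
    same q q<n q≢i with ℕ.<-cmp (position π q) (position π (toℕ i))
    ... | tri< lt _ _ = [ (λ eq → eq) , (λ eq → contradiction eq ne′) ]′ (itineraries-≡ uni uni′ lt)
    ... | tri> _ _ gt = [ (λ eq → contradiction eq ne′) , (λ eq → eq) ]′ (itineraries-≡ uni uni′ gt)
    ... | tri≈ _ eq _ = contradiction (begin
          q                  ≡⟨ toℕ-mod-< q<n ⟨
          toℕ (q mod n)      ≡⟨ cong toℕ (position-injective π inj eq) ⟩
          toℕ (toℕ i mod n)  ≡⟨ cong toℕ (mod-toℕ i) ⟩
          toℕ i              ∎) q≢i
      where open ≡-Reasoning

  -- The pattern of a primitive word

  module _ (b : Vec (Fin 2) n) where

    shift≺? : ∀ i j → Dec (shiftⁿ i (periodic b) ≺[ tent ] shiftⁿ j (periodic b))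
    shift≺? i j with ≺-compare tent n (shiftⁿ i (periodic b)) (shiftⁿ j (periodic b))
    ... | inj₁ ag         = no (≺-irrefl tent (agree⇒≐ b ag))
    ... | inj₂ (inj₁ i≺j) = yes i≺j
    ... | inj₂ (inj₂ j≺i) = no (≺-asym tent j≺i)

    rank : Fin n → ℕ
    rank i = length (filter (λ j → shift≺? (toℕ j) (toℕ i)) (allFin n))

    rank<n : ∀ i → rank i < n
    rank<n i = subst (rank i <_) (List.length-tabulate (λ j → j))
      -- The shift by `i` is not below itself, so at least one index is not counted.
      (List.filter-notAll _ (allFin n) (lose (∈-allFin i) (≺-irrefl tent (λ _ → refl))))

    rank-mono : ∀ {i j} → shiftⁿ (toℕ i) (periodic b) ≺[ tent ] shiftⁿ (toℕ j) (periodic b) → rank i < rank j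
    rank-mono {i} i≺j = length-filter-strict _ _ (λ k≺i → ≺-trans tent k≺i i≺j)
      (∈-allFin i) i≺j (≺-irrefl tent (λ _ → refl))

    -- With values counted from 0 this is the permutation assigned to a primitive word; in other
    -- words equal shifts share a rank.
    Π : Vec (Fin n) n
    Π = tabulate (λ i → fromℕ< (rank<n i))

    toℕ-Π : ∀ i → toℕ (lookup Π i) ≡ rank i
    toℕ-Π i = trans (cong toℕ (Vec.lookup∘tabulate (λ i → fromℕ< (rank<n i)) i)) (Fin.toℕ-fromℕ< (rank<n i))

    -- Shifts of a primitive word are pairwise distinct and hence comparable, so the strictly
    -- monotone `rank` is injective and reflects the order.
    primitive⇒pattern : Primitive b → IsPatternOf tent b Π
    primitive⇒pattern prim = inj , λ i j → mk⇔
      (λ lt → reflect i j (subst₂ _<_ (toℕ-Π i) (toℕ-Π j) lt))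
      (λ i≺j → subst₂ _<_ (sym (toℕ-Π i)) (sym (toℕ-Π j)) (rank-mono i≺j))
      where
      _⊏_ : Fin n → Fin n → Set
      i ⊏ j = shiftⁿ (toℕ i) (periodic b) ≺[ tent ] shiftⁿ (toℕ j) (periodic b)
      compare : ∀ i j → i ≡ j ⊎ (i ⊏ j ⊎ j ⊏ i)
      compare i j with ≺-compare tent n (shiftⁿ (toℕ i) (periodic b)) (shiftⁿ (toℕ j) (periodic b))
      ... | inj₂ d  = inj₂ d
      ... | inj₁ ag with ℕ.<-cmp (toℕ i) (toℕ j)
      ...   | tri< lt _ _ = contradiction (agree⇒≐ b ag) (primitive⇒shifts-≢ b prim lt (Fin.toℕ<n j))
      ...   | tri≈ _ eq _ = inj₁ (Fin.toℕ-injective eq)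
      ...   | tri> _ _ gt = contradiction (λ m → sym (agree⇒≐ b ag m)) (primitive⇒shifts-≢ b prim gt (Fin.toℕ<n i))
      reflect : ∀ i j → rank i < rank j → i ⊏ j
      reflect i j lt with compare i j
      ... | inj₁ refl       = contradiction lt (ℕ.<-irrefl refl)
      ... | inj₂ (inj₁ i⊏j) = i⊏j
      ... | inj₂ (inj₂ j⊏i) = contradiction (rank-mono j⊏i) (ℕ.<-asym lt)
      inj : Injective _≡_ _≡_ (lookup Π)
      inj {i} {j} eq with compare i j
      ... | inj₁ i≡j        = i≡j
      ... | inj₂ (inj₁ i⊏j) = contradiction (trans (sym (toℕ-Π i)) (trans (cong toℕ eq) (toℕ-Π j))) (ℕ.<⇒≢ (rank-mono i⊏j))
      ... | inj₂ (inj₂ j⊏i) = contradiction (trans (sym (toℕ-Π j)) (trans (cong toℕ (sym eq)) (toℕ-Π i))) (ℕ.<⇒≢ (rank-mono j⊏i))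

  -- Induction on the value `v`: the entry of value `v` in `π` is below the one of value `suc v`,
  -- hence also in `π′`, where it is at least `v` already. Exchanging the permutations gives
  -- equality.
  pattern-unique : ∀ b π π′ → IsPatternOf tent b π → IsPatternOf tent b π′ → π ≡ π′
  pattern-unique b π π′ pat pat′ = lookup-ext (λ i → Fin.toℕ-injective
    (ℕ.≤-antisym (below π π′ pat pat′ _ i refl) (below π′ π pat′ pat _ i refl)))
    where
    below : ∀ π π′ → IsPatternOf tent b π → IsPatternOf tent b π′ →
            ∀ v i → toℕ (lookup π i) ≡ v → v ≤ toℕ (lookup π′ i)
    below π π′ pat pat′ zero i _ = z≤n
    below π π′ pat@(inj , iff) pat′@(_ , iff′) (suc v) i eq
      with injective⇒surjective inj (fromℕ< v<n)
      where
      v<n : v < n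
      v<n = ℕ.<-trans (ℕ.n<1+n v) (subst (_< n) eq (Fin.toℕ<n (lookup π i)))
    ... | j , eqj = ℕ.≤-<-trans (below π π′ pat pat′ v j πj≡v)
                      (from (iff′ j i) (to (iff j i) (subst₂ _<_ (sym πj≡v) (sym eq) (ℕ.n<1+n v))))
      where
      πj≡v : toℕ (lookup π j) ≡ v
      πj≡v = trans (cong toℕ eqj) (Fin.toℕ-fromℕ< _)

-- The Möbius function

-- The bijections below take this form: lists without repetition and with the same elements have
-- equal sums and lengths.
unique⇒↭ : ∀ {A : Set} {xs ys : List A} → Unique xs → Unique ys →
           (∀ {x} → x ∈ xs → x ∈ ys) → (∀ {x} → x ∈ ys → x ∈ xs) → xs ↭ ys
unique⇒↭ u v f g = ∼bag⇒↭ (unique∧set⇒bag u v (mk⇔ f g))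

∑ : ∀ {A : Set} → List A → (A → ℤ) → ℤ
∑ xs f = foldr _⊕_ (+ 0) (map f xs)

module _ {A : Set} where

  ∑-cong : ∀ {f g : A → ℤ} xs → (∀ {x} → x ∈ xs → f x ≡ g x) → ∑ xs f ≡ ∑ xs g
  ∑-cong []       eq = refl
  ∑-cong (x ∷ xs) eq = cong₂ _⊕_ (eq (here refl)) (∑-cong xs (eq ∘ there))

  ∑-map : ∀ {B : Set} (h : B → A) (f : A → ℤ) xs → ∑ (map h xs) f ≡ ∑ xs (f ∘ h)
  ∑-map h f xs = cong (foldr _⊕_ (+ 0)) (sym (List.map-∘ xs))

  ∑-+ : ∀ (f g : A → ℤ) xs → ∑ xs (λ x → f x ⊕ g x) ≡ ∑ xs f ⊕ ∑ xs g
  ∑-+ f g []       = refl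
  ∑-+ f g (x ∷ xs) = trans (cong (f x ⊕ g x ⊕_) (∑-+ f g xs)) (interchange ℤ.+-commutativeSemigroup (f x) (g x) (∑ xs f) (∑ xs g))

  ∑-*ˡ : ∀ c (f : A → ℤ) xs → ∑ xs (λ x → c ⊗ f x) ≡ c ⊗ ∑ xs f
  ∑-*ˡ c f []       = sym (ℤ.*-zeroʳ c)
  ∑-*ˡ c f (x ∷ xs) = trans (cong (c ⊗ f x ⊕_) (∑-*ˡ c f xs)) (sym (ℤ.*-distribˡ-+ c (f x) _))

  ∑-zero : ∀ (xs : List A) → ∑ xs (λ _ → + 0) ≡ + 0
  ∑-zero []       = refl
  ∑-zero (x ∷ xs) = trans (ℤ.+-identityˡ _) (∑-zero xs)

  ∑-one : ∀ (xs : List A) → ∑ xs (λ _ → + 1) ≡ + length xs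
  ∑-one []       = refl
  ∑-one (x ∷ xs) = cong (+ 1 ⊕_) (∑-one xs)

  ∑-↭ : ∀ (f : A → ℤ) {xs ys} → xs ↭ ys → ∑ xs f ≡ ∑ ys f
  ∑-↭ f ↭.refl         = refl
  ∑-↭ f (↭.prep x p)   = cong (f x ⊕_) (∑-↭ f p)
  ∑-↭ f (↭.swap x y p) =
    trans (cong (λ z → f x ⊕ (f y ⊕ z)) (∑-↭ f p)) (x∙yz≈y∙xz ℤ.+-commutativeSemigroup (f x) (f y) _)
  ∑-↭ f (↭.trans p q)  = trans (∑-↭ f p) (∑-↭ f q)

  ∑-split : ∀ {P : A → Set} (P? : Decidable P) (f : A → ℤ) xs →
            ∑ xs f ≡ ∑ (filter P? xs) f ⊕ ∑ (filter (¬? ∘ P?) xs) f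
  ∑-split P? f []       = refl
  ∑-split P? f (x ∷ xs) with P? x
  ... | yes _ = trans (cong (f x ⊕_) (∑-split P? f xs)) (sym (ℤ.+-assoc (f x) _ _))
  ... | no _  = trans (cong (f x ⊕_) (∑-split P? f xs)) (x∙yz≈y∙xz ℤ.+-commutativeSemigroup (f x) (∑ (filter P? xs) f) (∑ (filter (¬? ∘ P?) xs) f))

∑-swap : ∀ {A B : Set} (f : A → B → ℤ) xs ys →
         ∑ xs (λ x → ∑ ys (f x)) ≡ ∑ ys (λ y → ∑ xs (λ x → f x y))
∑-swap f []       ys = sym (∑-zero ys)
∑-swap f (x ∷ xs) ys = trans (cong (∑ ys (f x) ⊕_) (∑-swap f xs ys)) (sym (∑-+ (f x) _ ys))

-- Divisors and square-free numbers

divisors : ℕ → List ℕ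
divisors m = filter (_∣? m) (upTo (suc m))

divisors-unique : ∀ m → Unique (divisors m)
divisors-unique m = Unique.filter⁺ (_∣? m) (Unique.upTo⁺ (suc m))

∈-divisors⁺ : ∀ {d m} .{{_ : NonZero m}} → d ∣ m → d ∈ divisors m
∈-divisors⁺ d∣m = ∈-filter⁺ (_∣? _) (∈-upTo⁺ (s≤s (∣⇒≤ d∣m))) d∣m

∈-divisors⁻ : ∀ {d} m → d ∈ divisors m → d ∣ m
∈-divisors⁻ m d∈ = proj₂ (∈-filter⁻ (_∣? m) {xs = upTo (suc m)} d∈)

∈-primeDivisors⁺ : ∀ {p d} .{{_ : NonZero d}} → Prime p → p ∣ d → p ∈ primeDivisors d
∈-primeDivisors⁺ pp p∣d = ∈-filter⁺ (λ p → prime? p ×-dec p ∣? _) (∈-upTo⁺ (s≤s (∣⇒≤ p∣d))) (pp , p∣d)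

∈-primeDivisors⁻ : ∀ {p} d → p ∈ primeDivisors d → Prime p × p ∣ d
∈-primeDivisors⁻ d p∈ = proj₂ (∈-filter⁻ (λ p → prime? p ×-dec p ∣? d) {xs = upTo (suc d)} p∈)

primeDivisors-unique : ∀ d → Unique (primeDivisors d)
primeDivisors-unique d = Unique.filter⁺ (λ p → prime? p ×-dec p ∣? d) (Unique.upTo⁺ (suc d))

SquareFree : ℕ → Set
SquareFree d = ∀ m → ¬ (2 + m) * (2 + m) ∣ d

squareFree⇔ : ∀ d .{{_ : NonZero d}} → squareFree d ≡ true ⇔ SquareFree d
squareFree⇔ d = mk⇔ sound complete
  where
  test : ℕ → Bool
  test m = not (⌊_⌋ ((2 + m) * (2 + m) ∣? d))
  sound : squareFree d ≡ true → SquareFree d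
  sound eq m sq∣d = toWitnessFalse {a? = (2 + m) * (2 + m) ∣? d}
    (All.lookup (All.all⁺ test (upTo d) (from T-≡ eq)) (∈-upTo⁺ m<d)) sq∣d
    where
    -- The bounded test reaches every square divisor: `2 + m` is at most its square, which is at
    -- most `d`.
    m<d : m < d
    m<d = ℕ.≤-trans (ℕ.≤-trans (ℕ.n≤1+n (suc m)) (ℕ.m≤m*n (2 + m) (2 + m))) (∣⇒≤ sq∣d)
  complete : SquareFree d → squareFree d ≡ true
  complete sf = to T-≡ (All.all⁻ test (All.universal (λ m → fromWitnessFalse {a? = (2 + m) * (2 + m) ∣? d} (sf m)) (upTo d)))

module _ {q} (pq : Prime q) where

  private instance
    q≢0 : NonZero q
    q≢0 = prime⇒nonZero pq

  -- In `q * m ≡ k * d` the prime `q` divides `k`, and it cancels from both sides.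
  ∣-prime-cancel : ∀ {d m} → ¬ q ∣ d → d ∣ q * m → d ∣ m
  ∣-prime-cancel {d} {m} q∤d (divides k eq) with euclidsLemma k d pq (subst (q ∣_) eq (m∣m*n m))
  ... | inj₂ q∣d              = contradiction q∣d q∤d
  ... | inj₁ (divides k′ eq′) = divides k′ (ℕ.*-cancelˡ-≡ m (k′ * d) q (begin
    q * m         ≡⟨ eq ⟩
    k * d         ≡⟨ cong (_* d) (trans eq′ (ℕ.*-comm k′ q)) ⟩
    q * k′ * d    ≡⟨ ℕ.*-assoc q k′ d ⟩
    q * (k′ * d)  ∎))
    where open ≡-Reasoning

  private
    product≢0 : ∀ e .{{_ : NonZero e}} → NonZero (q * e)
    product≢0 e = ℕ.m*n≢0 q e

  -- If `q` divided a square that divides `q * e`, then `q * q` would divide `q * e` and `q` would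
  -- divide `e`. So each such square is prime to `q` and divides `e`.
  squareFree-prime* : ∀ e .{{_ : NonZero e}} → ¬ q ∣ e → squareFree (q * e) ≡ squareFree e
  squareFree-prime* e q∤e = ⇔→≡ {z = true} (mk⇔
    (λ eq → from (squareFree⇔ e) (λ m sq∣e → to (squareFree⇔ (q * e) {{product≢0 e}}) eq m (∣n⇒∣m*n q sq∣e)))
    (λ eq → from (squareFree⇔ (q * e) {{product≢0 e}}) (λ m sq∣qe → to (squareFree⇔ e) eq m (∣-prime-cancel (q∤sq m sq∣qe) sq∣qe))))
    where
    q∤sq : ∀ m → (2 + m) * (2 + m) ∣ q * e → ¬ q ∣ (2 + m) * (2 + m)
    q∤sq m sq∣qe q∣sq with euclidsLemma (2 + m) (2 + m) pq q∣sq
    ... | inj₁ q∣m = q∤e (*-cancelˡ-∣ q (∣-trans (*-pres-∣ q∣m q∣m) sq∣qe))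
    ... | inj₂ q∣m = q∤e (*-cancelˡ-∣ q (∣-trans (*-pres-∣ q∣m q∣m) sq∣qe))

  length-primeDivisors-prime* : ∀ e .{{_ : NonZero e}} → ¬ q ∣ e →
                                length (primeDivisors (q * e)) ≡ suc (length (primeDivisors e))
  length-primeDivisors-prime* e q∤e = ↭-length (unique⇒↭ {ys = q ∷ primeDivisors e} (primeDivisors-unique (q * e))
    (All.tabulate (λ p∈ → λ { refl → q∤e (proj₂ (∈-primeDivisors⁻ e p∈)) }) ∷ primeDivisors-unique e) fwd bwd)
    where
    fwd : ∀ {p} → p ∈ primeDivisors (q * e) → p ∈ q ∷ primeDivisors e
    fwd p∈ with ∈-primeDivisors⁻ (q * e) p∈
    ... | pp , p∣qe with euclidsLemma q e pp p∣qe
    ...   | inj₂ p∣e = there (∈-primeDivisors⁺ pp p∣e)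
    ...   | inj₁ p∣q with prime⇒irreducible pq p∣q
    ...     | inj₁ refl = contradiction pp ¬prime[1]
    ...     | inj₂ refl = here refl
    bwd : ∀ {p} → p ∈ q ∷ primeDivisors e → p ∈ primeDivisors (q * e)
    bwd (here refl) = ∈-primeDivisors⁺ {{product≢0 e}} pq (m∣m*n e)
    bwd (there p∈) with ∈-primeDivisors⁻ e p∈
    ... | pp , p∣e = ∈-primeDivisors⁺ {{product≢0 e}} pp (∣n⇒∣m*n q p∣e)

  μ-prime*-∤ : ∀ e .{{_ : NonZero e}} → ¬ q ∣ e → μ (q * e) ≡ -[1+ 0 ] ⊗ μ e
  μ-prime*-∤ e q∤e rewrite squareFree-prime* e q∤e | length-primeDivisors-prime* e q∤e with squareFree e
  ... | true  = refl
  ... | false = refl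

  μ-prime*-∣ : ∀ e .{{_ : NonZero e}} → q ∣ e → μ (q * e) ≡ + 0
  μ-prime*-∣ e q∣e with squareFree (q * e) in eq
  ... | false = refl
  ... | true  = contradiction (*-monoʳ-∣ q q∣e) (square∤ q pq)
    where
    -- The prime is generalised to `q′` so that it can be matched as `suc (suc m)`, the form in
    -- which `SquareFree` speaks of square roots.
    square∤ : ∀ q′ → Prime q′ → ¬ q′ * q′ ∣ q * e
    square∤ (suc (suc m)) _ = to (squareFree⇔ (q * e) {{product≢0 e}}) eq m

  -- The multiples of `q` among the divisors of `q * m` are the `q * e` with `e ∣ m`, and the others
  -- are the divisors of `m` prime to `q`. The terms with `q ∣ e` vanish, and the remaining `q * e`
  -- cancel against the `e`.
  μ-sum-prime* : ∀ m .{{_ : NonZero m}} → ∑ (divisors (q * m)) μ ≡ + 0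
  μ-sum-prime* m = begin
    ∑ (divisors (q * m)) μ
      ≡⟨ ∑-split (q ∣?_) μ (divisors (q * m)) ⟩
    ∑ (filter (q ∣?_) (divisors (q * m))) μ ⊕ ∑ (filter (¬? ∘ (q ∣?_)) (divisors (q * m))) μ
      ≡⟨ cong₂ _⊕_ (∑-↭ μ multiples) (∑-↭ μ nonMultiples) ⟩
    ∑ (map (q *_) (divisors m)) μ ⊕ x
      ≡⟨ cong (_⊕ x) (∑-map (q *_) μ (divisors m)) ⟩
    ∑ (divisors m) (μ ∘ (q *_)) ⊕ x
      ≡⟨ cong (_⊕ x) (∑-split (q ∣?_) (μ ∘ (q *_)) (divisors m)) ⟩
    ∑ (filter (q ∣?_) (divisors m)) (μ ∘ (q *_)) ⊕ ∑ coprimes (μ ∘ (q *_)) ⊕ x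
      ≡⟨ cong₂ (λ a b → a ⊕ b ⊕ x) vanish negate ⟩
    + 0 ⊕ -[1+ 0 ] ⊗ x ⊕ x
      ≡⟨ cong (_⊕ x) (trans (ℤ.+-identityˡ _) (ℤ.-1*i≡-i x)) ⟩
    - x ⊕ x
      ≡⟨ ℤ.+-inverseˡ x ⟩
    + 0 ∎
    where
    open ≡-Reasoning
    instance
      qm≢0 : NonZero (q * m)
      qm≢0 = product≢0 m
    coprimes = filter (¬? ∘ (q ∣?_)) (divisors m)
    x = ∑ coprimes μ
    multiples : filter (q ∣?_) (divisors (q * m)) ↭ map (q *_) (divisors m)
    multiples = unique⇒↭ (Unique.filter⁺ _ (divisors-unique (q * m)))
      (Unique.map⁺ (λ {a} {b} → ℕ.*-cancelˡ-≡ a b q) (divisors-unique m)) fwd bwd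
      where
      fwd : ∀ {d} → d ∈ filter (q ∣?_) (divisors (q * m)) → d ∈ map (q *_) (divisors m)
      fwd d∈ with ∈-filter⁻ (q ∣?_) {xs = divisors (q * m)} d∈
      ... | d∈′ , divides e refl = subst (_∈ map (q *_) (divisors m)) (ℕ.*-comm q e)
        (∈-map⁺ (q *_) (∈-divisors⁺ (*-cancelˡ-∣ q (subst (_∣ q * m) (ℕ.*-comm e q) (∈-divisors⁻ (q * m) d∈′)))))
      bwd : ∀ {d} → d ∈ map (q *_) (divisors m) → d ∈ filter (q ∣?_) (divisors (q * m))
      bwd d∈ with ∈-map⁻ (q *_) d∈
      ... | e , e∈ , refl = ∈-filter⁺ (q ∣?_) (∈-divisors⁺ (*-monoʳ-∣ q (∈-divisors⁻ m e∈))) (m∣m*n e)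
    nonMultiples : filter (¬? ∘ (q ∣?_)) (divisors (q * m)) ↭ coprimes
    nonMultiples = unique⇒↭ (Unique.filter⁺ _ (divisors-unique (q * m))) (Unique.filter⁺ _ (divisors-unique m)) fwd bwd
      where
      fwd : ∀ {d} → d ∈ filter (¬? ∘ (q ∣?_)) (divisors (q * m)) → d ∈ coprimes
      fwd d∈ with ∈-filter⁻ (¬? ∘ (q ∣?_)) {xs = divisors (q * m)} d∈
      ... | d∈′ , q∤d = ∈-filter⁺ (¬? ∘ (q ∣?_)) (∈-divisors⁺ (∣-prime-cancel q∤d (∈-divisors⁻ (q * m) d∈′))) q∤d
      bwd : ∀ {d} → d ∈ coprimes → d ∈ filter (¬? ∘ (q ∣?_)) (divisors (q * m))
      bwd d∈ with ∈-filter⁻ (¬? ∘ (q ∣?_)) {xs = divisors m} d∈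
      ... | d∈′ , q∤d = ∈-filter⁺ (¬? ∘ (q ∣?_)) (∈-divisors⁺ (∣n⇒∣m*n q (∈-divisors⁻ m d∈′))) q∤d
    divisor≢0 : ∀ {e} → e ∈ divisors m → NonZero e
    divisor≢0 {zero}  e∈ = contradiction (0∣⇒≡0 (∈-divisors⁻ m e∈)) (≢-nonZero⁻¹ m)
    divisor≢0 {suc _} _  = _
    vanish : ∑ (filter (q ∣?_) (divisors m)) (μ ∘ (q *_)) ≡ + 0
    vanish = trans (∑-cong (filter (q ∣?_) (divisors m)) (λ e∈ →
        let e∈′ , q∣e = ∈-filter⁻ (q ∣?_) {xs = divisors m} e∈
        in μ-prime*-∣ _ {{divisor≢0 e∈′}} q∣e))
      (∑-zero (filter (q ∣?_) (divisors m)))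
    negate : ∑ coprimes (μ ∘ (q *_)) ≡ -[1+ 0 ] ⊗ x
    negate = trans (∑-cong coprimes (λ e∈ →
        let e∈′ , q∤e = ∈-filter⁻ (¬? ∘ (q ∣?_)) {xs = divisors m} e∈
        in μ-prime*-∤ _ {{divisor≢0 e∈′}} q∤e))
      (∑-*ˡ (-[1+ 0 ]) μ coprimes)

primeDivisor : ∀ m .{{_ : NonZero m}} → m ≢ 1 → ∃[ q ] (Prime q × q ∣ m)
primeDivisor m m≢1 with factorise m
... | record { factors = []     ; isFactorisation = eq } = contradiction eq m≢1
... | record { factors = q ∷ qs ; isFactorisation = eq ; factorsPrime = pq All.∷ _ } =
  q , pq , subst (q ∣_) (sym eq) (m∣m*n _)

μ-sum : ∀ m .{{_ : NonZero m}} → m ≢ 1 → ∑ (divisors m) μ ≡ + 0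
μ-sum m m≢1 with primeDivisor m m≢1
... | q , pq , q∣m@(divides m′ refl) =
  subst (λ m → ∑ (divisors m) μ ≡ + 0) (ℕ.*-comm q m′) (μ-sum-prime* pq m′ {{quotient≢0 q∣m}})

-- Counting odd words

unique-map : ∀ {A B : Set} {f : A → B} {xs} → (∀ {x y} → x ∈ xs → y ∈ xs → f x ≡ f y → x ≡ y) →
             Unique xs → Unique (map f xs)
unique-map inj []           = []
unique-map inj (x∉xs ∷ xs!) =
  All.map⁺ (All.tabulate (λ y∈ eq → All.lookup x∉xs y∈ (inj (here refl) (there y∈) eq))) ∷
  unique-map (λ x∈ y∈ → inj (there x∈) (there y∈)) xs!

χ : ∀ {A : Set} → Dec A → ℤ
χ a? = if does a? then + 1 else + 0

∑-filter : ∀ {A : Set} {P : A → Set} (P? : Decidable P) (f : A → ℤ) xs →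
           ∑ (filter P? xs) f ≡ ∑ xs (λ x → f x ⊗ χ (P? x))
∑-filter P? f []       = refl
∑-filter P? f (x ∷ xs) with P? x
... | yes _ = cong₂ _⊕_ (sym (ℤ.*-identityʳ (f x))) (∑-filter P? f xs)
... | no _  = trans (∑-filter P? f xs) (sym (trans (cong (_⊕ ∑ xs (λ x → f x ⊗ χ (P? x))) (ℤ.*-zeroʳ (f x))) (ℤ.+-identityˡ _)))

length-filter : ∀ {A : Set} {P : A → Set} (P? : Decidable P) xs → + length (filter P? xs) ≡ ∑ xs (χ ∘ P?)
length-filter P? xs = trans (sym (∑-one (filter P? xs)))
  (trans (∑-filter P? (λ _ → + 1) xs) (∑-cong xs (λ _ → ℤ.*-identityˡ _)))

odd-* : ∀ c d → c % 2 ≡ 1 → d % 2 ≡ 1 → (c * d) % 2 ≡ 1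
odd-* c d oc od = trans (%-distribˡ-* c d 2) (cong₂ (λ x y → (x * y) % 2) oc od)

odd-*ˡ : ∀ c d → (c * d) % 2 ≡ 1 → c % 2 ≡ 1
odd-*ˡ c d o with parity c
... | inj₂ oc = oc
... | inj₁ ec = contradiction o (even≢odd (trans (%-distribˡ-* c d 2) (cong (λ x → (x * (d % 2)) % 2) ec)))

odd-*ʳ : ∀ c d → (c * d) % 2 ≡ 1 → d % 2 ≡ 1
odd-*ʳ c d o = odd-*ˡ d c (trans (cong (_% 2) (ℕ.*-comm d c)) o)

module _ {k} (σ : Signs k) (s : Word k) where

  minusCount-+ : ∀ m N → minusCount σ s (m + N) ≡ minusCount σ s m + minusCount σ (shiftⁿ m s) N
  minusCount-+ m zero    = trans (cong (minusCount σ s) (ℕ.+-identityʳ m)) (sym (ℕ.+-identityʳ _))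
  minusCount-+ m (suc N) = begin
    minusCount σ s (m + suc N)                    ≡⟨ cong (minusCount σ s) (ℕ.+-suc m N) ⟩
    minusCount σ s (m + N) + x                    ≡⟨ cong (_+ x) (minusCount-+ m N) ⟩
    minusCount σ s m + minusCount σ (shiftⁿ m s) N + x  ≡⟨ ℕ.+-assoc (minusCount σ s m) _ x ⟩
    minusCount σ s m + minusCount σ (shiftⁿ m s) (suc N)  ∎
    where
    open ≡-Reasoning
    x = isMinus (lookup σ (s (m + N)))

  minusCount-* : ∀ {e} → Period s e → ∀ d → minusCount σ s (d * e) ≡ d * minusCount σ s e
  minusCount-* {e} per zero    = refl
  minusCount-* {e} per (suc d) = trans (minusCount-+ e (d * e))
    (cong (λ x → minusCount σ s e + x) (trans (minusCount-cong σ (d * e) (λ i _ → per i)) (minusCount-* per d)))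

period-mod : ∀ {k} {s : Word k} {p} .{{_ : NonZero p}} → Period s p → ∀ i → s (i % p) ≡ s i
period-mod {s = s} {p} per i = trans (sym (period-* (i / p) per (i % p)))
  (cong s (trans (ℕ.+-comm (i / p * p) (i % p)) (sym (m≡m%n+[m/n]*n i p))))

-- Used in both directions: repeating a block up to a multiple of its length, and cutting a word
-- down to one of its periods.
resample : ∀ {k n} .{{_ : NonZero n}} m → Vec (Fin k) n → Vec (Fin k) m
resample m w = tabulate (λ i → periodic w (toℕ i))

periodic-resample : ∀ {k n} .{{_ : NonZero n}} m .{{_ : NonZero m}} (w : Vec (Fin k) n) →
                    Period (periodic w) m → periodic (resample m w) ≐ periodic w
periodic-resample m w per i = trans (Vec.lookup∘tabulate (λ i → periodic w (toℕ i)) (i mod m))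
  (trans (cong (periodic w) (toℕ-mod i)) (period-mod per i))

periodic-injective : ∀ {k n} .{{_ : NonZero n}} {v w : Vec (Fin k) n} → periodic v ≐ periodic w → v ≡ w
periodic-injective {v = v} {w} eq = lookup-ext (λ i →
  trans (sym (periodic-toℕ v i)) (trans (eq (toℕ i)) (periodic-toℕ w i)))

-- Lists of binary words

words : ∀ n → List (Vec (Fin 2) n)
words zero    = [] ∷ []
words (suc n) = cartesianProductWith _∷_ (allFin 2) (words n)

words-unique : ∀ n → Unique (words n)
words-unique zero    = [] ∷ []
words-unique (suc n) = Unique.cartesianProductWith⁺ _∷_ Vec.∷-injective (Unique.allFin⁺ 2) (words-unique n)

∈-words : ∀ {n} (w : Vec (Fin 2) n) → w ∈ words n
∈-words []      = here refl
∈-words (x ∷ w) = ∈-cartesianProductWith⁺ _∷_ (∈-allFin x) (∈-words w)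

length-words : ∀ n → length (words n) ≡ 2 ^ n
length-words zero    = refl
length-words (suc n) = begin
  length (map (0F ∷_) ws ++ (map (1F ∷_) ws ++ []))  ≡⟨ List.length-++ (map (0F ∷_) ws) ⟩
  length (map (0F ∷_) ws) + length (map (1F ∷_) ws ++ [])
    ≡⟨ cong₂ _+_ (List.length-map (0F ∷_) ws)
         (trans (cong length (List.++-identityʳ (map (1F ∷_) ws))) (List.length-map (1F ∷_) ws)) ⟩
  length ws + length ws                              ≡⟨ cong (λ x → x + x) (length-words n) ⟩
  2 ^ n + 2 ^ n                                      ≡⟨ cong (λ x → 2 ^ n + x) (ℕ.+-identityʳ (2 ^ n)) ⟨
  2 ^ suc n                                          ∎
  where
  open ≡-Reasoning
  ws = words n

module _ {n} .{{_ : NonZero n}} where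

  odd? : Decidable (Odd {n})
  odd? b = minusCount tent (periodic b) n % 2 ℕ.≟ 1

  primitive? : Decidable (Primitive {2} {n})
  primitive? b with minimalPeriod b
  ... | p , _ , per , min with p ℕ.≟ n
  ...   | yes refl = yes (∣⇒primitive b min)
  ...   | no p≢n   = no (λ prim → p≢n (∣-antisym (min n (period-length b)) (primitive⇒∣ b prim p per)))

oddWords : ∀ n .{{_ : NonZero n}} → List (Vec (Fin 2) n)
oddWords n = filter odd? (words n)

oddWords-unique : ∀ n .{{_ : NonZero n}} → Unique (oddWords n)
oddWords-unique n = Unique.filter⁺ odd? (words-unique n)

∈-oddWords⁺ : ∀ {n} .{{_ : NonZero n}} (w : Vec (Fin 2) n) → Odd w → w ∈ oddWords n
∈-oddWords⁺ w o = ∈-filter⁺ odd? (∈-words w) o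

∈-oddWords⁻ : ∀ {n} .{{_ : NonZero n}} {w : Vec (Fin 2) n} → w ∈ oddWords n → Odd w
∈-oddWords⁻ {n} w∈ = proj₂ (∈-filter⁻ odd? {xs = words n} w∈)

flipAt-involutive : ∀ {n} .{{_ : NonZero n}} i (b : Vec (Fin 2) n) → flipAt i (flipAt i b) ≡ b
flipAt-involutive i b = trans (Vec.updateAt-updateAt i b)
  (Vec.updateAt-id-local i b (Fin.opposite-involutive (lookup b i)))

-- Flipping the first letter exchanges odd and even words.
length-oddWords : ∀ n .{{_ : NonZero n}} → + (2 ^ n) ≡ + 2 ⊗ + length (oddWords n)
length-oddWords n = begin
  + (2 ^ n)                                       ≡⟨ cong +_ (length-words n) ⟨
  + length (words n)                              ≡⟨ ∑-one (words n) ⟨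
  ∑ (words n) (λ _ → + 1)                         ≡⟨ ∑-split odd? (λ _ → + 1) (words n) ⟩
  ∑ (oddWords n) (λ _ → + 1) ⊕ ∑ evenWords (λ _ → + 1)
    ≡⟨ cong₂ _⊕_ (∑-one (oddWords n)) (∑-one evenWords) ⟩
  + length (oddWords n) ⊕ + length evenWords      ≡⟨ cong (λ x → + length (oddWords n) ⊕ + x) even≡odd ⟩
  + (length (oddWords n) + length (oddWords n))
    ≡⟨ cong (λ x → + (length (oddWords n) + x)) (ℕ.+-identityʳ (length (oddWords n))) ⟨
  + (2 * length (oddWords n))                     ≡⟨ ℤ.pos-* 2 (length (oddWords n)) ⟩
  + 2 ⊗ + length (oddWords n)                     ∎
  where
  open ≡-Reasoning
  evenWords = filter (¬? ∘ odd?) (words n)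
  i : Fin n
  i = 0 mod n
  flipped : map (flipAt i) (oddWords n) ↭ evenWords
  flipped = unique⇒↭
    (Unique.map⁺ (λ {v} {w} eq → trans (sym (flipAt-involutive i v)) (trans (cong (flipAt i) eq) (flipAt-involutive i w)))
      (oddWords-unique n))
    (Unique.filter⁺ (¬? ∘ odd?) (words-unique n)) fwd bwd
    where
    fwd : ∀ {w} → w ∈ map (flipAt i) (oddWords n) → w ∈ evenWords
    fwd w∈ with ∈-map⁻ (flipAt i) w∈
    ... | v , v∈ , refl = ∈-filter⁺ (¬? ∘ odd?) (∈-words (flipAt i v)) (flipAt-even i v (∈-oddWords⁻ v∈))
    bwd : ∀ {w} → w ∈ evenWords → w ∈ map (flipAt i) (oddWords n)
    bwd {w} w∈ with ∈-filter⁻ (¬? ∘ odd?) {xs = words n} w∈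
    ... | _ , even = subst (_∈ map (flipAt i) (oddWords n)) (flipAt-involutive i w)
      (∈-map⁺ (flipAt i) (∈-oddWords⁺ (flipAt i w) (flipAt-odd i w even)))
  even≡odd : length evenWords ≡ length (oddWords n)
  even≡odd = trans (sym (↭-length flipped)) (List.length-map (flipAt i) (oddWords n))

-- A word of length `d * e` with period `e` repeats a block of length `e` exactly `d` times, and
-- since `d` is odd the word and the block have the same parity.
length-oddWords-period : ∀ d e .{{_ : NonZero e}} .{{_ : NonZero (d * e)}} → d % 2 ≡ 1 →
  length (filter (λ w → period? w e) (oddWords (d * e))) ≡ length (oddWords e)
length-oddWords-period d e od = sym (trans (sym (List.length-map (resample (d * e)) (oddWords e)))
  (↭-length (unique⇒↭ (Unique.map⁺ inj (oddWords-unique e))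
    (Unique.filter⁺ (λ w → period? w e) (oddWords-unique (d * e))) fwd bwd)))
  where
  n = d * e
  extend-≐ : ∀ (u : Vec (Fin 2) e) → periodic (resample n u) ≐ periodic u
  extend-≐ u = periodic-resample n u (period-* d (period-length u))
  inj : ∀ {u v : Vec (Fin 2) e} → resample n u ≡ resample n v → u ≡ v
  inj {u} {v} eq = periodic-injective (λ i →
    trans (sym (extend-≐ u i)) (trans (cong (λ w → periodic w i) eq) (extend-≐ v i)))
  count : ∀ (u : Vec (Fin 2) e) (w : Vec (Fin 2) n) → periodic w ≐ periodic u →
          minusCount tent (periodic w) n ≡ d * minusCount tent (periodic u) e
  count u w eq = trans (minusCount-cong tent n (λ i _ → eq i)) (minusCount-* tent (periodic u) (period-length u) d)
  fwd : ∀ {w} → w ∈ map (resample n) (oddWords e) → w ∈ filter (λ w → period? w e) (oddWords n)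
  fwd w∈ with ∈-map⁻ (resample n) w∈
  ... | u , u∈ , refl = ∈-filter⁺ (λ w → period? w e)
    (∈-oddWords⁺ (resample n u) (trans (cong (_% 2) (count u (resample n u) (extend-≐ u))) (odd-* d (minusCount tent (periodic u) e) od (∈-oddWords⁻ u∈))))
    (λ i → trans (extend-≐ u (e + i)) (trans (period-length u i) (sym (extend-≐ u i))))
  bwd : ∀ {w} → w ∈ filter (λ w → period? w e) (oddWords n) → w ∈ map (resample n) (oddWords e)
  bwd {w} w∈ with ∈-filter⁻ (λ w → period? w e) {xs = oddWords n} w∈
  ... | w∈′ , per = subst (_∈ map (resample n) (oddWords e))
      (periodic-injective (λ i → trans (extend-≐ u i) (restrict-≐ i)))
      (∈-map⁺ (resample n) (∈-oddWords⁺ u (odd-*ʳ d (minusCount tent (periodic u) e)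
        (trans (cong (_% 2) (sym (count u w (λ i → sym (restrict-≐ i))))) (∈-oddWords⁻ w∈′)))))
    where
    u = resample e w
    restrict-≐ : periodic u ≐ periodic w
    restrict-≐ = periodic-resample e w per

-- Möbius inversion over the periods

module _ (n : ℕ) .{{_ : NonZero n}} where

  oddDivisor? : Decidable (λ i → suc i ∣ n × suc i % 2 ≡ 1)
  oddDivisor? i = (suc i ∣? n) ×-dec (suc i % 2 ℕ.≟ 1)

  -- The number i stands for the odd divisor suc i, as in tentSum.
  oddDivisors : List ℕ
  oddDivisors = filter oddDivisor? (upTo n)

  -- For `d = suc i`, half of the words of length `n / d` are odd, and these are the blocks of the
  -- odd words of length `n` with period `n / d`.
  count-period : ∀ {i} → i ∈ oddDivisors →
    + (2 ^ (n / suc i)) ≡ + 2 ⊗ ∑ (oddWords n) (λ w → χ (period? w (n / suc i)))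
  count-period {i} i∈ with ∈-filter⁻ oddDivisor? {xs = upTo n} i∈
  ... | _ , d∣n , od = begin
    + (2 ^ e)                  ≡⟨ length-oddWords e ⟩
    + 2 ⊗ + length (oddWords e)
      ≡⟨ cong (λ x → + 2 ⊗ + x) (transport n (m*[n/m]≡n d∣n)) ⟨
    + 2 ⊗ + length (filter (λ w → period? w e) (oddWords n))
      ≡⟨ cong (+ 2 ⊗_) (length-filter (λ w → period? w e) (oddWords n)) ⟩
    + 2 ⊗ ∑ (oddWords n) (λ w → χ (period? w e))  ∎
    where
    open ≡-Reasoning
    e = n / suc i
    instance
      e≢0 : NonZero e
      e≢0 = ℕ.m*n≢0⇒n≢0 (suc i) {{subst NonZero (sym (m*[n/m]≡n d∣n)) (≢-nonZero (≢-nonZero⁻¹ n))}}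
    -- With `n` generalised to `m`, the equation can be matched and turns `m` into `suc i * e`.
    transport : ∀ m .{{_ : NonZero m}} → suc i * e ≡ m →
                length (filter (λ w → period? w e) (oddWords m)) ≡ length (oddWords e)
    transport _ refl = length-oddWords-period (suc i) e od

  -- Let `p` be the least period and `n ≡ k * p`. For `d ∣ n` the quotient `n / d` is a period iff
  -- `p ∣ n / d`, that is, iff `d ∣ k`. Since `k` is odd, the sum runs over all divisors of `k`.
  μ-sum-periods : ∀ w → Odd w → (prim? : Dec (Primitive w)) →
    ∑ oddDivisors (λ i → μ (suc i) ⊗ χ (period? w (n / suc i))) ≡ χ prim?
  μ-sum-periods w odd prim? with minimalPeriod w
  ... | p , p≢0 , per , min with min n (period-length w)
  ...   | p∣n@(divides k n≡kp) = begin
    ∑ oddDivisors (λ i → μ (suc i) ⊗ χ (period? w (n / suc i)))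
      ≡⟨ ∑-filter period/? (μ ∘ suc) oddDivisors ⟨
    ∑ (filter period/? oddDivisors) (μ ∘ suc)
      ≡⟨ ∑-map suc μ (filter period/? oddDivisors) ⟨
    ∑ (map suc (filter period/? oddDivisors)) μ
      ≡⟨ ∑-↭ μ same ⟩
    ∑ (divisors k) μ
      ≡⟨ evaluate prim? ⟩
    χ prim? ∎
    where
    open ≡-Reasoning
    period/? : Decidable (λ i → Period (periodic w) (n / suc i))
    period/? i = period? w (n / suc i)
    instance
      p-nonZero : NonZero p
      p-nonZero = p≢0
      k-nonZero : NonZero k
      k-nonZero = quotient≢0 p∣n
    -- The number of 1s in the word is `k` times the number in one period, and this product is odd.
    odd-k : k % 2 ≡ 1
    odd-k = odd-*ˡ k (minusCount tent (periodic w) p)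
      (trans (cong (_% 2) (trans (sym (minusCount-* tent (periodic w) per k)) (cong (minusCount tent (periodic w)) (sym n≡kp)))) odd)
    same : map suc (filter period/? oddDivisors) ↭ divisors k
    same = unique⇒↭ (Unique.map⁺ ℕ.suc-injective (Unique.filter⁺ period/? (Unique.filter⁺ oddDivisor? (Unique.upTo⁺ n))))
      (divisors-unique k) fwd bwd
      where
      fwd : ∀ {d} → d ∈ map suc (filter period/? oddDivisors) → d ∈ divisors k
      fwd d∈ with ∈-map⁻ suc d∈
      ... | i , i∈ , refl with ∈-filter⁻ period/? {xs = oddDivisors} i∈
      ... | i∈′ , per′ with ∈-filter⁻ oddDivisor? {xs = upTo n} i∈′
      ... | _ , d∣n , _ = ∈-divisors⁺ {m = k} (*-cancelʳ-∣ p (subst (suc i * p ∣_) n≡kp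
        (subst (suc i * p ∣_) (m*[n/m]≡n d∣n) (*-monoʳ-∣ (suc i) (min (n / suc i) per′)))))
      bwd : ∀ {d} → d ∈ divisors k → d ∈ map suc (filter period/? oddDivisors)
      bwd {zero} d∈ = contradiction (0∣⇒≡0 (∈-divisors⁻ k d∈)) (≢-nonZero⁻¹ k)
      bwd {suc i} d∈ with ∈-divisors⁻ k d∈
      ... | d∣k@(divides c k≡cd) = ∈-map⁺ suc (∈-filter⁺ period/?
          (∈-filter⁺ oddDivisor? (∈-upTo⁺ (∣⇒≤ d∣n)) (d∣n , odd-*ʳ c (suc i) (trans (cong (_% 2) (sym k≡cd)) odd-k)))
          (subst (Period (periodic w)) (sym n/d≡cp) (period-* c per)))
        where
        d∣n : suc i ∣ n
        d∣n = ∣-trans d∣k (subst (k ∣_) (sym n≡kp) (m∣m*n p))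
        n≡cpd : n ≡ c * p * suc i
        n≡cpd = begin
          n                ≡⟨ n≡kp ⟩
          k * p            ≡⟨ cong (_* p) k≡cd ⟩
          c * suc i * p    ≡⟨ ℕ.*-assoc c (suc i) p ⟩
          c * (suc i * p)  ≡⟨ cong (c *_) (ℕ.*-comm (suc i) p) ⟩
          c * (p * suc i)  ≡⟨ ℕ.*-assoc c p (suc i) ⟨
          c * p * suc i    ∎
        n/d≡cp : n / suc i ≡ c * p
        n/d≡cp = trans (cong (_/ suc i) n≡cpd) (m*n/n≡m (c * p) (suc i))
    -- A primitive word has `p ≡ n`, so `k ≡ 1` and the sum computes to 1; for any other word `k` is
    -- not 1 and the sum vanishes.
    evaluate : (prim? : Dec (Primitive w)) → ∑ (divisors k) μ ≡ χ prim?
    evaluate (yes prim) = cong (λ k → ∑ (divisors k) μ) k≡1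
      where
      p≡n : p ≡ n
      p≡n = ∣-antisym p∣n (primitive⇒∣ w prim p per)
      k≡1 : k ≡ 1
      k≡1 = ℕ.*-cancelʳ-≡ k 1 p (trans (sym n≡kp) (trans (sym p≡n) (sym (ℕ.*-identityˡ p))))
    evaluate (no ¬prim) = μ-sum k (λ k≡1 → ¬prim (∣⇒primitive w (λ m pm →
            subst (_∣ m) (sym (trans n≡kp (trans (cong (_* p) k≡1) (ℕ.*-identityˡ p)))) (min m pm))))

  primitiveOddWords : List (Vec (Fin 2) n)
  primitiveOddWords = filter primitive? (oddWords n)

  -- Each power of 2 is twice a number of odd words; after exchanging the sums, the sum over `d` for
  -- a fixed word is the indicator of primitivity.
  count-primitiveOddWords : + (2 * length primitiveOddWords) ≡ tentSum n
  count-primitiveOddWords = sym (begin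
    ∑ oddDivisors (λ i → μ (suc i) ⊗ + (2 ^ (n / suc i)))
      ≡⟨ ∑-cong oddDivisors (λ {i} i∈ → trans (cong (μ (suc i) ⊗_) (count-period i∈)) (rearrange i)) ⟩
    ∑ oddDivisors (λ i → + 2 ⊗ ∑ ws (λ w → μ (suc i) ⊗ has w i))
      ≡⟨ ∑-*ˡ (+ 2) (λ i → ∑ ws (λ w → μ (suc i) ⊗ has w i)) oddDivisors ⟩
    + 2 ⊗ ∑ oddDivisors (λ i → ∑ ws (λ w → μ (suc i) ⊗ has w i))
      ≡⟨ cong (+ 2 ⊗_) (∑-swap (λ i w → μ (suc i) ⊗ has w i) oddDivisors ws) ⟩
    + 2 ⊗ ∑ ws (λ w → ∑ oddDivisors (λ i → μ (suc i) ⊗ has w i))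
      ≡⟨ cong (+ 2 ⊗_) (∑-cong ws (λ {w} w∈ → μ-sum-periods w (∈-oddWords⁻ w∈) (primitive? w))) ⟩
    + 2 ⊗ ∑ ws (λ w → χ (primitive? w))
      ≡⟨ cong (+ 2 ⊗_) (length-filter primitive? ws) ⟨
    + 2 ⊗ + length primitiveOddWords
      ≡⟨ ℤ.pos-* 2 (length primitiveOddWords) ⟨
    + (2 * length primitiveOddWords) ∎)
    where
    open ≡-Reasoning
    ws = oddWords n
    has : Vec (Fin 2) n → ℕ → ℤ
    has w i = χ (period? w (n / suc i))
    rearrange : ∀ i → μ (suc i) ⊗ (+ 2 ⊗ ∑ ws (λ w → has w i)) ≡ + 2 ⊗ ∑ ws (λ w → μ (suc i) ⊗ has w i)
    rearrange i = begin
      μ (suc i) ⊗ (+ 2 ⊗ x)    ≡⟨ ℤ.*-assoc (μ (suc i)) (+ 2) x ⟨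
      μ (suc i) ⊗ + 2 ⊗ x      ≡⟨ cong (_⊗ x) (ℤ.*-comm (μ (suc i)) (+ 2)) ⟩
      + 2 ⊗ μ (suc i) ⊗ x      ≡⟨ ℤ.*-assoc (+ 2) (μ (suc i)) x ⟩
      + 2 ⊗ (μ (suc i) ⊗ x)    ≡⟨ cong (+ 2 ⊗_) (∑-*ˡ (μ (suc i)) (λ w → has w i) ws) ⟨
      + 2 ⊗ ∑ ws (λ w → μ (suc i) ⊗ has w i)  ∎
      where x = ∑ ws (λ w → has w i)

  ∈-primitiveOddWords⁻ : ∀ {w} → w ∈ primitiveOddWords → Odd w × Primitive w
  ∈-primitiveOddWords⁻ w∈ = let w∈′ , prim = ∈-filter⁻ primitive? {xs = oddWords n} w∈ in ∈-oddWords⁻ w∈′ , prim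

-- Enumerating the patterns

module _ (n : ℕ) .{{_ : NonZero n}} where

  Π-injective : ∀ {v w} → v ∈ primitiveOddWords n → w ∈ primitiveOddWords n → Π v ≡ Π w → v ≡ w
  Π-injective {v} {w} v∈ w∈ eq =
    let ov , pv = ∈-primitiveOddWords⁻ n v∈
        ow , pw = ∈-primitiveOddWords⁻ n w∈
    in odd-pattern-injective v w (Π v) ov ow (primitive⇒pattern v pv)
         (subst (IsPatternOf tent w) (sym eq) (primitive⇒pattern w pw))

  patterns : List (Vec (Fin n) n)
  patterns = map Π (primitiveOddWords n)

  ∈-patterns⁻ : ∀ {π} → π ∈ patterns → IsPattern tent n π
  ∈-patterns⁻ π∈ =
    let w , w∈ , π≡Πw = ∈-map⁻ Π π∈
        _ , prim = ∈-primitiveOddWords⁻ n w∈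
    in w , prim , subst (IsPatternOf tent w) (sym π≡Πw) (primitive⇒pattern w prim)

  odd-pattern∈patterns : ∀ π w → Odd w → Primitive w → IsPatternOf tent w π → π ∈ patterns
  odd-pattern∈patterns π w odd prim pat = subst (_∈ patterns)
    (pattern-unique w (Π w) π (primitive⇒pattern w prim) pat)
    (∈-map⁺ Π (∈-filter⁺ primitive? (∈-oddWords⁺ w odd) prim))

  -- A word with an even number of 1s is traded for an odd one with the same pattern.
  ∈-patterns⁺ : ∀ {π} → IsPattern tent n π → π ∈ patterns
  ∈-patterns⁺ {π} (b , prim , pat) = helper (odd? b)
    where
    helper : Dec (Odd b) → π ∈ patterns
    helper (yes odd) = odd-pattern∈patterns π b odd prim pat
    helper (no even) = let b′ , odd′ , prim′ , pat′ = even-pattern⇒odd-pattern b π even pat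
                       in odd-pattern∈patterns π b′ odd′ prim′ pat′

  patterns-card : HasCard (IsPattern tent n) (length (primitiveOddWords n))
  patterns-card =
    patterns ,
    unique-map Π-injective (Unique.filter⁺ primitive? (oddWords-unique n)) ,
    (λ _ → mk⇔ ∈-patterns⁻ ∈-patterns⁺) ,
    List.length-map Π (primitiveOddWords n)

-- Here `N` counts all patterns, `n` times the number of classes under rotation, so the formula
-- appears with the denominator `2n` cleared.
theorem3p4 : (n : ℕ) → .{{_ : NonZero n}} →
    ∃[ N ] (HasCard (IsPattern tent n) N × + (2 * N) ≡ tentSum n)
theorem3p4 n = length (primitiveOddWords n) , patterns-card n , count-primitiveOddWords n
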